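{- Let $p\ge 2$ and $n\ge\max\{4,2p\}$. Let $F_0\subseteq E(K_n)$ be an edge set with $H_{F_0}\cong P_3\cup(p-2)K_2$, and let $M\subseteq E(K_n)$ be a matching with $p$ edges. Then $$Kf(K_n-F_0)-Kf(K_n-M)=\frac{2n}{(n-1)(n-2)(n-3)}.$$
   Context: $K_n$ is the complete graph on $n$ vertices and $K_n-F$ is obtained from it by deleting the edges in $F$ (keeping all vertices). The deletion graph of an edge set $F$ is $H_F=(V(F),F)$ with $V(F)=\bigcup_{e\in F}e$. $P_3$ is the path on $3$ vertices, and $P_3\cup(p-2)K_2$ is the disjoint union of $P_3$ and $p-2$ single edges. A matching is a set of pairwise disjoint edges. For a connected graph $G$ with Laplacian $L(G)=D(G)-A(G)$, the effective resistance between distinct vertices is $R_G(x,y)=(e_x-e_y)^TL(G)^+(e_x-e_y)$ ($L(G)^+$ the Moore--Penrose inverse, $e_x$ the standard basis vector of vertex $x$), and the Kirchhoff index is $Kf(G)=\sum_{\{x,y\}}R_G(x,y)$, the sum over all unordered pairs of distinct vertices. -}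

module Defs where

open import Data.Bool.Base using (Bool; true; false; T; not; _∧_; _∨_; if_then_else_)
open import Data.Bool.Properties using (∨-comm; ∧-zeroʳ)
open import Data.Fin.Base as Fin using (Fin; zero; suc; toℕ)
import Data.Fin.Properties as Fin
open import Data.Nat.Base as ℕ using (ℕ; zero; suc)
import Data.Nat.Properties as ℕ
open import Data.Product.Base using (_×_; _,_; proj₁; proj₂; ∃-syntax; Σ-syntax)
open import Data.Rational.Base
open import Data.Rational.Properties
open import Data.Rational.Solver using (module +-*-Solver)
open import Data.Refinement using (Refinement-syntax; value; _,_)
open import Data.Sum.Base using (_⊎_; inj₁; inj₂)
open import Data.Vec.Functional using (Vector)
open import Function.Base using (_∘_)
open import Function.Bundles using (_↔_; Inverse)
open import Relation.Binary.PropositionalEquality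
open import Relation.Nullary using (¬_; does; yes; no)
open import Relation.Nullary.Decidable using (dec-true; dec-false)
open import Algebra.Bundles using (CommutativeRing)
open import Algebra.Properties.Semiring.Sum
  (CommutativeRing.semiring +-*-commutativeRing)
  using (sum; ∑-distrib-+; ∑-comm; *-distribˡ-sum; *-distribʳ-sum; sum-cong-≗)
import Algebra.Properties.CommutativeMonoid.Sum ℕ.+-0-commutativeMonoid as ℕΣ

------------------------------------------------------------------------
-- Linear algebra
--
-- Scalars are rational: a Laplacian has integer entries, so its real
-- Moore-Penrose inverse is the rational one.

private variable
  l m n o : ℕ
  V W : Set

Matrix : ℕ → ℕ → Set
Matrix m n = Vector (Vector ℚ n) m

infixl 7 _·_ _⊗_ _ᵥ*_
infixr 7 _*ᵥ_
infixl 6 _-ᵥ_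

_·_ : Vector ℚ n → Vector ℚ n → ℚ
u · v = sum (λ i → u i * v i)

_-ᵥ_ : Vector ℚ n → Vector ℚ n → Vector ℚ n
(u -ᵥ v) i = u i - v i

_*ᵥ_ : Matrix m n → Vector ℚ n → Vector ℚ m
(A *ᵥ v) i = A i · v

_ᵥ*_ : Vector ℚ m → Matrix m n → Vector ℚ n
(u ᵥ* A) j = u · (λ i → A i j)

_⊗_ : Matrix l m → Matrix m n → Matrix l n
(A ⊗ B) i k = sum (λ j → A i j * B j k)

basis : Fin n → Vector ℚ n
basis x i = if does (i Fin.≟ x) then 1ℚ else 0ℚ

Symmetric : Matrix n n → Set
Symmetric A = ∀ i j → A i j ≡ A j i

record IsMoorePenroseInverse (A : Matrix m n) (X : Matrix n m) : Set where
  field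
    AXA≈A  : ∀ i j → (A ⊗ X ⊗ A) i j ≡ A i j
    XAX≈X  : ∀ i j → (X ⊗ A ⊗ X) i j ≡ X i j
    AX-sym : Symmetric (A ⊗ X)
    XA-sym : Symmetric (X ⊗ A)

------------------------------------------------------------------------
-- Existence of the Moore-Penrose inverse (Greville's column recursion)

private
  module S = +-*-Solver

  ·-congˡ : {u v : Vector ℚ n} (w : Vector ℚ n) → u ≗ v → u · w ≡ v · w
  ·-congˡ w eq = sum-cong-≗ (λ i → cong (_* w i) (eq i))

  ·-congʳ : (w : Vector ℚ n) {u v : Vector ℚ n} → u ≗ v → w · u ≡ w · v
  ·-congʳ w eq = sum-cong-≗ (λ i → cong (w i *_) (eq i))

  ·-comm : (u v : Vector ℚ n) → u · v ≡ v · u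
  ·-comm u v = sum-cong-≗ (λ i → *-comm (u i) (v i))

  ·-+ˡ : (u v w : Vector ℚ n) → (λ i → u i + v i) · w ≡ u · w + v · w
  ·-+ˡ {n} u v w = trans (sum-cong-≗ (λ i → *-distribʳ-+ (w i) (u i) (v i)))
                         (∑-distrib-+ {n} (λ i → u i * w i) (λ i → v i * w i))

  ·-*ˡ : (s : ℚ) (u w : Vector ℚ n) → (λ i → s * u i) · w ≡ s * (u · w)
  ·-*ˡ {n} s u w = trans (sum-cong-≗ (λ i → *-assoc s (u i) (w i)))
                         (sym (*-distribˡ-sum {n} s (λ i → u i * w i)))

  -- (u + s v) · w
  ·-linˡ : (s : ℚ) (u v w : Vector ℚ n) →
           (λ i → u i + s * v i) · w ≡ u · w + s * (v · w)
  ·-linˡ s u v w = trans (·-+ˡ u _ w) (cong ((u · w) +_) (·-*ˡ s v w))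

  -- (u - s v) · w
  ·-subˡ : (s : ℚ) (u v w : Vector ℚ n) →
           (λ i → u i - s * v i) · w ≡ u · w - s * (v · w)
  ·-subˡ s u v w = begin
    (λ i → u i - s * v i) · w      ≡⟨ ·-congˡ w (λ i → cong (u i +_) (neg-distribˡ-* s (v i))) ⟩
    (λ i → u i + (- s) * v i) · w  ≡⟨ ·-linˡ (- s) u v w ⟩
    u · w + (- s) * (v · w)        ≡⟨ cong ((u · w) +_) (sym (neg-distribˡ-* s (v · w))) ⟩
    u · w - s * (v · w)            ∎
    where open ≡-Reasoning

  ·--ˡ : (u v w : Vector ℚ n) → (u -ᵥ v) · w ≡ u · w - v · w
  ·--ˡ u v w = begin
    (u -ᵥ v) · w                 ≡⟨ ·-congˡ w (λ i → cong (λ z → u i - z) (sym (*-identityˡ (v i)))) ⟩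
    (λ i → u i - 1ℚ * v i) · w   ≡⟨ ·-subˡ 1ℚ u v w ⟩
    u · w - 1ℚ * (v · w)         ≡⟨ cong (λ z → u · w - z) (*-identityˡ (v · w)) ⟩
    u · w - v · w                ∎
    where open ≡-Reasoning

  ·-subʳ : (w u v : Vector ℚ n) (s : ℚ) →
           w · (λ i → u i - v i * s) ≡ w · u - (w · v) * s
  ·-subʳ w u v s = begin
    w · (λ i → u i - v i * s)  ≡⟨ ·-comm w _ ⟩
    (λ i → u i - v i * s) · w  ≡⟨ ·-congˡ w (λ i → cong (λ z → u i - z) (*-comm (v i) s)) ⟩
    (λ i → u i - s * v i) · w  ≡⟨ ·-subˡ s u v w ⟩
    u · w - s * (v · w)        ≡⟨ cong₂ _-_ (·-comm u w) (trans (*-comm s _) (cong (_* s) (·-comm v w))) ⟩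
    w · u - (w · v) * s        ∎
    where open ≡-Reasoning

  assoc : (u : Vector ℚ m) (A : Matrix m n) (v : Vector ℚ n) →
          (u ᵥ* A) · v ≡ u · (A *ᵥ v)
  assoc {m} {n} u A v = begin
    sum (λ j → sum (λ i → u i * A i j) * v j)
      ≡⟨ sum-cong-≗ (λ j → *-distribʳ-sum {m} (v j) (λ i → u i * A i j)) ⟩
    sum (λ j → sum (λ i → u i * A i j * v j))
      ≡⟨ ∑-comm {n} {m} (λ j i → u i * A i j * v j) ⟩
    sum (λ i → sum (λ j → u i * A i j * v j))
      ≡⟨ sum-cong-≗ (λ i → sum-cong-≗ {n} (λ j → *-assoc (u i) (A i j) (v j))) ⟩
    sum (λ i → sum (λ j → u i * (A i j * v j)))
      ≡⟨ sum-cong-≗ (λ i → sym (*-distribˡ-sum {n} (u i) (λ j → A i j * v j))) ⟩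
    sum (λ i → u i * sum (λ j → A i j * v j)) ∎
    where open ≡-Reasoning

  ≗0⇒·≡0 : {u : Vector ℚ n} (w : Vector ℚ n) → (∀ i → u i ≡ 0ℚ) → u · w ≡ 0ℚ
  ≗0⇒·≡0 {u = u} w u≗0 = begin
    u · w                  ≡⟨ ·-congˡ w (λ i → trans (u≗0 i) (sym (trans (cong (0ℚ *_) (u≗0 i)) (*-zeroˡ 0ℚ)))) ⟩
    (λ i → 0ℚ * u i) · w   ≡⟨ ·-*ˡ 0ℚ u w ⟩
    0ℚ * (u · w)           ≡⟨ *-zeroˡ (u · w) ⟩
    0ℚ                     ∎
    where open ≡-Reasoning

  square-nonNeg : (p : ℚ) → 0ℚ ≤ p * p
  square-nonNeg p with ≤-total 0ℚ p
  ... | inj₁ 0≤p = subst (_≤ p * p) (*-zeroʳ p)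
                     (*-monoˡ-≤-nonNeg p {{nonNegative 0≤p}} 0≤p)
  ... | inj₂ p≤0 = subst (_≤ p * p) (*-zeroʳ p)
                     (*-monoˡ-≤-nonPos p {{nonPositive p≤0}} p≤0)

  ·-nonNeg : (u : Vector ℚ n) → 0ℚ ≤ u · u
  ·-nonNeg {zero}  u = ≤-refl
  ·-nonNeg {suc n} u =
    subst (_≤ u · u) (+-identityˡ 0ℚ) (+-mono-≤ (square-nonNeg (u zero)) (·-nonNeg (u ∘ suc)))

  zero-summandˡ : (p q : ℚ) → 0ℚ ≤ p → 0ℚ ≤ q → p + q ≡ 0ℚ → p ≡ 0ℚ
  zero-summandˡ p q 0≤p 0≤q eq = ≤-antisym p≤0 0≤p
    where
    p≤0 : p ≤ 0ℚ
    p≤0 = subst₂ _≤_ (+-identityʳ p) eq (+-monoʳ-≤ p 0≤q)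

  square≡0 : (p : ℚ) → p * p ≡ 0ℚ → p ≡ 0ℚ
  square≡0 p eq with p ≟ 0ℚ
  ... | yes p≡0 = p≡0
  ... | no  p≢0 = begin
    p                ≡⟨ sym (*-identityˡ p) ⟩
    1ℚ * p           ≡⟨ cong (_* p) (sym (*-inverseˡ p)) ⟩
    1/ p * p * p     ≡⟨ *-assoc (1/ p) p p ⟩
    1/ p * (p * p)   ≡⟨ cong (1/ p *_) eq ⟩
    1/ p * 0ℚ        ≡⟨ *-zeroʳ (1/ p) ⟩
    0ℚ               ∎
    where
    open ≡-Reasoning
    instance _ = ≢-nonZero p≢0

  ·≡0 : (u : Vector ℚ n) → u · u ≡ 0ℚ → ∀ i → u i ≡ 0ℚ
  ·≡0 u eq zero    = square≡0 (u zero)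
    (zero-summandˡ _ _ (square-nonNeg (u zero)) (·-nonNeg (u ∘ suc)) eq)
  ·≡0 u eq (suc i) = ·≡0 (u ∘ suc)
    (zero-summandˡ _ _ (·-nonNeg (u ∘ suc)) (square-nonNeg (u zero))
      (trans (+-comm ((u ∘ suc) · (u ∘ suc)) (u zero * u zero)) eq)) i

  1+·≢0 : (u : Vector ℚ n) → 1ℚ + u · u ≢ 0ℚ
  1+·≢0 u eq = 1≢0 (zero-summandˡ 1ℚ (u · u) (nonNegative⁻¹ 1ℚ) (·-nonNeg u) eq)

  module Step (A′ : Matrix m (suc n)) (B : Matrix n m)
              (mp : IsMoorePenroseInverse (λ i j → A′ i (suc j)) B) where
    open IsMoorePenroseInverse mp

    A : Matrix m n
    A i j = A′ i (suc j)

    a : Vector ℚ m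
    a i = A′ i zero

    d : Vector ℚ n
    d = B *ᵥ a

    c : Vector ℚ m
    c = a -ᵥ A *ᵥ d

    ABa≈Ad : (A ⊗ B) *ᵥ a ≗ A *ᵥ d
    ABa≈Ad i = assoc (A i) B a

    BAd≈d : (B ⊗ A) *ᵥ d ≗ d
    BAd≈d i = trans (sym (assoc ((B ⊗ A) i) B a)) (·-congˡ a (XAX≈X i))

    ᵥ*-assoc : (b : Vector ℚ m) → (b ᵥ* A) ᵥ* B ≗ b ᵥ* (A ⊗ B)
    ᵥ*-assoc b k = assoc b A (λ j → B j k)

    module Row (b : Vector ℚ m)
      (cb-sym : ∀ i j → c i * b j ≡ c j * b i)
      (bA≈    : ∀ j → (b ᵥ* A) j ≡ d j - d j * (b · a))
      (c-ba   : ∀ i → c i * (b · a) ≡ c i)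
      (b-row  : ∀ k → (b ᵥ* (A ⊗ B)) k + (b · c) * b k ≡ b k) where

      open ≡-Reasoning

      X : Matrix (suc n) m
      X zero    k = b k
      X (suc j) k = B j k - d j * b k

      A′X : ∀ i k → (A′ ⊗ X) i k ≡ (A ⊗ B) i k + c i * b k
      A′X i k = begin
        a i * b k + A i · (λ j → B j k - d j * b k)
          ≡⟨ cong ((a i * b k) +_) (·-subʳ (A i) _ d (b k)) ⟩
        a i * b k + ((A ⊗ B) i k - (A *ᵥ d) i * b k)
          ≡⟨ S.solve 4 (λ a b x y → a S.:* b S.:+ (x S.:- y S.:* b) S.:= x S.:+ (a S.:- y) S.:* b) refl
               (a i) (b k) ((A ⊗ B) i k) ((A *ᵥ d) i) ⟩
        (A ⊗ B) i k + c i * b k ∎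

      XA′-col : ∀ i → (X ⊗ A′) (suc i) zero ≡ d i - d i * (b · a)
      XA′-col i = ·-subˡ (d i) (B i) b a

      XA′-block : ∀ i j → (X ⊗ A′) (suc i) (suc j) ≡ (B ⊗ A) i j - d i * (b ᵥ* A) j
      XA′-block i j = ·-subˡ (d i) (B i) b (λ k → A k j)

      A′XA′ : ∀ i j → (A′ ⊗ X ⊗ A′) i j ≡ A′ i j
      A′XA′ i j = begin
        (A′ ⊗ X) i · Aⱼ                          ≡⟨ ·-congˡ Aⱼ (A′X i) ⟩
        (λ k → (A ⊗ B) i k + c i * b k) · Aⱼ     ≡⟨ ·-linˡ (c i) ((A ⊗ B) i) b Aⱼ ⟩
        (A ⊗ B) i · Aⱼ + c i * (b · Aⱼ)          ≡⟨ last j ⟩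
        A′ i j                                   ∎
        where
        Aⱼ : Vector ℚ m
        Aⱼ k = A′ k j
        last : ∀ j → (A ⊗ B) i · (λ k → A′ k j) + c i * (b · (λ k → A′ k j)) ≡ A′ i j
        last zero = begin
          (A ⊗ B) i · a + c i * (b · a)       ≡⟨ cong₂ _+_ (ABa≈Ad i) (c-ba i) ⟩
          (A *ᵥ d) i + (a i - (A *ᵥ d) i)     ≡⟨ S.solve 2 (λ x y → x S.:+ (y S.:- x) S.:= y) refl ((A *ᵥ d) i) (a i) ⟩
          a i                                 ∎
        last (suc j) = begin
          (A ⊗ B ⊗ A) i j + c i * (b ᵥ* A) j
            ≡⟨ cong₂ (λ x y → x + c i * y) (AXA≈A i j) (bA≈ j) ⟩
          A i j + c i * (d j - d j * (b · a))
            ≡⟨ S.solve 4 (λ x c d t → x S.:+ c S.:* (d S.:- d S.:* t) S.:= x S.:+ (c S.:* d S.:- d S.:* (c S.:* t))) refl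
                 (A i j) (c i) (d j) (b · a) ⟩
          A i j + (c i * d j - d j * (c i * (b · a)))
            ≡⟨ cong (λ z → A i j + (c i * d j - d j * z)) (c-ba i) ⟩
          A i j + (c i * d j - d j * c i)
            ≡⟨ S.solve 3 (λ x c d → x S.:+ (c S.:* d S.:- d S.:* c) S.:= x) refl (A i j) (c i) (d j) ⟩
          A i j ∎

      row₀ : ∀ k → (X ⊗ A′ ⊗ X) zero k ≡ b k
      row₀ k = begin
        (b · a) * b k + (b ᵥ* A) · (λ j → B j k - d j * b k)
          ≡⟨ cong (((b · a) * b k) +_) (·-subʳ (b ᵥ* A) _ d (b k)) ⟩
        (b · a) * b k + (((b ᵥ* A) ᵥ* B) k - ((b ᵥ* A) · d) * b k)
          ≡⟨ cong₂ (λ x y → (b · a) * b k + (x - y * b k)) (ᵥ*-assoc b k) (assoc b A d) ⟩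
        (b · a) * b k + ((b ᵥ* (A ⊗ B)) k - (b · (A *ᵥ d)) * b k)
          ≡⟨ S.solve 4 (λ x b y z → x S.:* b S.:+ (y S.:- z S.:* b) S.:= y S.:+ (x S.:- z) S.:* b) refl
               (b · a) (b k) ((b ᵥ* (A ⊗ B)) k) (b · (A *ᵥ d)) ⟩
        (b ᵥ* (A ⊗ B)) k + (b · a - b · (A *ᵥ d)) * b k
          ≡⟨ cong (λ z → (b ᵥ* (A ⊗ B)) k + z * b k) (sym b·c) ⟩
        (b ᵥ* (A ⊗ B)) k + (b · c) * b k
          ≡⟨ b-row k ⟩
        b k ∎
        where
        b·c : b · c ≡ b · a - b · (A *ᵥ d)
        b·c = trans (·-comm b c)
                (trans (·--ˡ a (A *ᵥ d) b) (cong₂ _-_ (·-comm a b) (·-comm (A *ᵥ d) b)))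

      XA′X : ∀ i k → (X ⊗ A′ ⊗ X) i k ≡ X i k
      XA′X zero    k = row₀ k
      XA′X (suc i) k = begin
        (X ⊗ A′) (suc i) zero * b k + (λ j → (X ⊗ A′) (suc i) (suc j)) · Xₖ
          ≡⟨ cong₂ (λ x y → x * b k + y) (XA′-col i) (·-congˡ Xₖ (XA′-block i)) ⟩
        (d i - d i * (b · a)) * b k + (λ j → (B ⊗ A) i j - d i * (b ᵥ* A) j) · Xₖ
          ≡⟨ cong (((d i - d i * (b · a)) * b k) +_) (·-subˡ (d i) ((B ⊗ A) i) (b ᵥ* A) Xₖ) ⟩
        (d i - d i * (b · a)) * b k + ((B ⊗ A) i · Xₖ - d i * ((b ᵥ* A) · Xₖ))
          ≡⟨ cong (λ z → (d i - d i * (b · a)) * b k + (z - d i * ((b ᵥ* A) · Xₖ))) BA-Xₖ ⟩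
        (d i - d i * (b · a)) * b k + ((B i k - d i * b k) - d i * ((b ᵥ* A) · Xₖ))
          ≡⟨ S.solve 5 (λ d t b x y →
               (d S.:- d S.:* t) S.:* b S.:+ ((x S.:- d S.:* b) S.:- d S.:* y)
               S.:= x S.:- d S.:* (t S.:* b S.:+ y)) refl
               (d i) (b · a) (b k) (B i k) ((b ᵥ* A) · Xₖ) ⟩
        B i k - d i * ((b · a) * b k + (b ᵥ* A) · Xₖ)
          ≡⟨ cong (λ z → B i k - d i * z) (row₀ k) ⟩
        B i k - d i * b k ∎
        where
        Xₖ : Vector ℚ n
        Xₖ j = B j k - d j * b k
        BA-Xₖ : (B ⊗ A) i · Xₖ ≡ B i k - d i * b k
        BA-Xₖ = trans (·-subʳ ((B ⊗ A) i) _ d (b k))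
                  (cong₂ (λ x y → x - y * b k) (XAX≈X i k) (BAd≈d i))

      A′X-sym : Symmetric (A′ ⊗ X)
      A′X-sym i j = trans (A′X i j) (trans (cong₂ _+_ (AX-sym i j) (cb-sym i j)) (sym (A′X j i)))

      XA′-sym : Symmetric (X ⊗ A′)
      XA′-sym zero    zero    = refl
      XA′-sym zero    (suc j) = trans (bA≈ j) (sym (XA′-col j))
      XA′-sym (suc i) zero    = trans (XA′-col i) (sym (bA≈ i))
      XA′-sym (suc i) (suc j) = begin
        (X ⊗ A′) (suc i) (suc j)                 ≡⟨ XA′-block i j ⟩
        (B ⊗ A) i j - d i * (b ᵥ* A) j           ≡⟨ cong₂ (λ x y → x - d i * y) (XA-sym i j) (bA≈ j) ⟩
        (B ⊗ A) j i - d i * (d j - d j * (b · a))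
          ≡⟨ S.solve 4 (λ x d e t → x S.:- d S.:* (e S.:- e S.:* t) S.:= x S.:- e S.:* (d S.:- d S.:* t)) refl
               ((B ⊗ A) j i) (d i) (d j) (b · a) ⟩
        (B ⊗ A) j i - d j * (d i - d i * (b · a)) ≡⟨ cong (λ y → (B ⊗ A) j i - d j * y) (sym (bA≈ i)) ⟩
        (B ⊗ A) j i - d j * (b ᵥ* A) i           ≡⟨ sym (XA′-block j i) ⟩
        (X ⊗ A′) (suc j) (suc i)                 ∎

      result : Σ[ X ∈ Matrix (suc n) m ] IsMoorePenroseInverse A′ X
      result = X , record { AXA≈A = A′XA′ ; XAX≈X = XA′X ; AX-sym = A′X-sym ; XA-sym = XA′-sym }

    open ≡-Reasoning

    cA≈0 : ∀ j → (c ᵥ* A) j ≡ 0ℚ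
    cA≈0 j = begin
      c · Aⱼ                          ≡⟨ ·--ˡ a (A *ᵥ d) Aⱼ ⟩
      a · Aⱼ - (A *ᵥ d) · Aⱼ          ≡⟨ cong (λ z → a · Aⱼ - z) (·-congˡ Aⱼ Ad≈aAB) ⟩
      a · Aⱼ - (a ᵥ* (A ⊗ B)) · Aⱼ    ≡⟨ cong (λ z → a · Aⱼ - z) (assoc a (A ⊗ B) Aⱼ) ⟩
      a · Aⱼ - a · ((A ⊗ B) *ᵥ Aⱼ)    ≡⟨ cong (λ z → a · Aⱼ - z) (·-congʳ a (λ i → AXA≈A i j)) ⟩
      a · Aⱼ - a · Aⱼ                 ≡⟨ +-inverseʳ (a · Aⱼ) ⟩
      0ℚ                              ∎
      where
      Aⱼ : Vector ℚ m
      Aⱼ i = A i j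
      Ad≈aAB : A *ᵥ d ≗ a ᵥ* (A ⊗ B)
      Ad≈aAB i = trans (sym (ABa≈Ad i))
                   (trans (·-comm ((A ⊗ B) i) a) (·-congʳ a (AX-sym i)))

    c·a≡c·c : c · a ≡ c · c
    c·a≡c·c = sym (begin
      c · c                        ≡⟨ ·--ˡ a (A *ᵥ d) c ⟩
      a · c - (A *ᵥ d) · c         ≡⟨ cong₂ _-_ (·-comm a c) (·-comm (A *ᵥ d) c) ⟩
      c · a - c · (A *ᵥ d)         ≡⟨ cong (λ z → c · a - z) (sym (assoc c A d)) ⟩
      c · a - (c ᵥ* A) · d         ≡⟨ cong (λ z → c · a - z) (≗0⇒·≡0 d cA≈0) ⟩
      c · a - 0ℚ                   ≡⟨ +-identityʳ (c · a) ⟩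
      c · a                        ∎)

    step : Σ[ X ∈ Matrix (suc n) m ] IsMoorePenroseInverse A′ X
    step with c · c ≟ 0ℚ
    ... | no cc≢0 = Row.result b
          (λ i j → S.solve 3 (λ s x y → x S.:* (s S.:* y) S.:= y S.:* (s S.:* x)) refl s (c i) (c j))
          (λ j → begin
            (b ᵥ* A) j             ≡⟨ bA≈0 j ⟩
            0ℚ                     ≡⟨ S.solve 1 (λ x → S.con 0ℚ S.:= x S.:- x S.:* S.con 1ℚ) refl (d j) ⟩
            d j - d j * 1ℚ         ≡⟨ cong (λ z → d j - d j * z) (sym b·a) ⟩
            d j - d j * (b · a)    ∎)
          (λ i → trans (cong (c i *_) b·a) (*-identityʳ (c i)))
          (λ k → begin
            (b ᵥ* (A ⊗ B)) k + (b · c) * b k  ≡⟨ cong₂ (λ x y → x + y * b k) (bAB≈0 k) b·c ⟩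
            0ℚ + 1ℚ * b k                     ≡⟨ trans (+-identityˡ _) (*-identityˡ (b k)) ⟩
            b k                               ∎)
      where
      instance _ = ≢-nonZero cc≢0
      s : ℚ
      s = 1/ (c · c)
      b : Vector ℚ m
      b k = s * c k
      bA≈0 : ∀ j → (b ᵥ* A) j ≡ 0ℚ
      bA≈0 j = trans (·-*ˡ s c _) (trans (cong (s *_) (cA≈0 j)) (*-zeroʳ s))
      b·c : b · c ≡ 1ℚ
      b·c = trans (·-*ˡ s c c) (*-inverseˡ (c · c))
      b·a : b · a ≡ 1ℚ
      b·a = trans (·-*ˡ s c a) (trans (cong (s *_) c·a≡c·c) (*-inverseˡ (c · c)))
      bAB≈0 : ∀ k → (b ᵥ* (A ⊗ B)) k ≡ 0ℚ
      bAB≈0 k = trans (sym (ᵥ*-assoc b k)) (≗0⇒·≡0 (λ j → B j k) bA≈0)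
    ... | yes cc≡0 = Row.result b
          (λ i j → trans (c*≡0 i (b j)) (sym (c*≡0 j (b i))))
          (λ j → begin
            (b ᵥ* A) j                     ≡⟨ bA≈κd j ⟩
            κ * d j                        ≡⟨ S.solve 3 (λ κ x t → κ S.:* x S.:= (κ S.:* (S.con 1ℚ S.:+ t)) S.:* x S.:- x S.:* (κ S.:* t)) refl κ (d j) (d · d) ⟩
            κ * (1ℚ + d · d) * d j - d j * (κ * (d · d))
                                           ≡⟨ cong₂ (λ x y → x * d j - d j * y) (*-inverseˡ (1ℚ + d · d)) (sym b·a) ⟩
            1ℚ * d j - d j * (b · a)       ≡⟨ cong (λ z → z - d j * (b · a)) (*-identityˡ (d j)) ⟩
            d j - d j * (b · a)            ∎)
          (λ i → trans (c*≡0 i (b · a)) (sym (c≡0 i)))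
          (λ k → begin
            (b ᵥ* (A ⊗ B)) k + (b · c) * b k  ≡⟨ cong₂ (λ x y → x + y * b k) (bAB≈b k) b·c ⟩
            b k + 0ℚ * b k                    ≡⟨ cong (λ z → b k + z) (*-zeroˡ (b k)) ⟩
            b k + 0ℚ                          ≡⟨ +-identityʳ (b k) ⟩
            b k                               ∎)
      where
      instance _ = ≢-nonZero (1+·≢0 d)
      κ : ℚ
      κ = 1/ (1ℚ + d · d)
      b : Vector ℚ m
      b k = κ * (d ᵥ* B) k
      c≡0 : ∀ i → c i ≡ 0ℚ
      c≡0 = ·≡0 c cc≡0
      c*≡0 : ∀ i x → c i * x ≡ 0ℚ
      c*≡0 i x = trans (cong (_* x) (c≡0 i)) (*-zeroˡ x)
      b·c : b · c ≡ 0ℚ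
      b·c = trans (·-comm b c) (≗0⇒·≡0 b c≡0)
      bA≈κd : ∀ j → (b ᵥ* A) j ≡ κ * d j
      bA≈κd j = trans (·-*ˡ κ (d ᵥ* B) _) (cong (κ *_) (begin
        (d ᵥ* B) · (λ i → A i j)       ≡⟨ assoc d B _ ⟩
        d · (λ i → (B ⊗ A) i j)        ≡⟨ ·-comm d _ ⟩
        (λ i → (B ⊗ A) i j) · d        ≡⟨ ·-congˡ d (λ i → XA-sym i j) ⟩
        ((B ⊗ A) *ᵥ d) j               ≡⟨ BAd≈d j ⟩
        d j                            ∎))
      b·a : b · a ≡ κ * (d · d)
      b·a = trans (·-*ˡ κ (d ᵥ* B) a) (cong (κ *_) (assoc d B a))
      bAB≈b : ∀ k → (b ᵥ* (A ⊗ B)) k ≡ b k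
      bAB≈b k = begin
        (b ᵥ* (A ⊗ B)) k                 ≡⟨ sym (ᵥ*-assoc b k) ⟩
        (b ᵥ* A) · (λ j → B j k)         ≡⟨ ·-congˡ _ bA≈κd ⟩
        (λ j → κ * d j) · (λ j → B j k)  ≡⟨ ·-*ˡ κ d _ ⟩
        b k                              ∎

  greville : (A : Matrix m n) → Σ[ X ∈ Matrix n m ] IsMoorePenroseInverse A X
  greville {n = zero}  A = (λ ()) , record
    { AXA≈A = λ _ (); XAX≈X = λ (); AX-sym = λ _ _ → refl; XA-sym = λ () }
  greville {n = suc n} A with greville (λ i j → A i (suc j))
  ... | B , mp = Step.step A B mp

infix 9 _⁺

-- `abstract`, so that _⁺ is only ever used through its characterisation:
-- ⁺-isMoorePenroseInverse and ⁺-unique.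
abstract
  _⁺ : Matrix m n → Matrix n m
  A ⁺ = proj₁ (greville A)

  ⁺-isMoorePenroseInverse : (A : Matrix m n) → IsMoorePenroseInverse A (A ⁺)
  ⁺-isMoorePenroseInverse A = proj₂ (greville A)

private
  ⊗-assoc : (A : Matrix l m) (B : Matrix m n) (C : Matrix n o) →
            ∀ i j → (A ⊗ B ⊗ C) i j ≡ (A ⊗ (B ⊗ C)) i j
  ⊗-assoc A B C i j = assoc (A i) B (λ k → C k j)

  ⊗-congˡ : {A B : Matrix l m} (C : Matrix m n) → (∀ i j → A i j ≡ B i j) →
            ∀ i j → (A ⊗ C) i j ≡ (B ⊗ C) i j
  ⊗-congˡ C eq i j = ·-congˡ (λ k → C k j) (eq i)

  ⊗-congʳ : (C : Matrix l m) {A B : Matrix m n} → (∀ i j → A i j ≡ B i j) →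
            ∀ i j → (C ⊗ A) i j ≡ (C ⊗ B) i j
  ⊗-congʳ C eq i j = ·-congʳ (C i) (λ k → eq k j)

  symmetric-swap : {P Q : Matrix n n} → Symmetric P → Symmetric Q →
                   ∀ i j → (P ⊗ Q) i j ≡ (Q ⊗ P) j i
  symmetric-swap {P = P} {Q} P-sym Q-sym i j = sum-cong-≗ (λ k →
    trans (*-comm (P i k) (Q k j)) (cong₂ _*_ (Q-sym k j) (P-sym i k)))

isMoorePenroseInverse-unique : {A : Matrix m n} {X Y : Matrix n m} →
  IsMoorePenroseInverse A X → IsMoorePenroseInverse A Y → ∀ i j → X i j ≡ Y i j
isMoorePenroseInverse-unique {A = A} {X} {Y} hX hY i j = begin
  X i j                ≡⟨ sym (HX.XAX≈X i j) ⟩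
  (X ⊗ A ⊗ X) i j      ≡⟨ ⊗-congˡ X XA≈YA i j ⟩
  (Y ⊗ A ⊗ X) i j      ≡⟨ ⊗-assoc Y A X i j ⟩
  (Y ⊗ (A ⊗ X)) i j    ≡⟨ ⊗-congʳ Y AX≈AY i j ⟩
  (Y ⊗ (A ⊗ Y)) i j    ≡⟨ sym (⊗-assoc Y A Y i j) ⟩
  (Y ⊗ A ⊗ Y) i j      ≡⟨ HY.XAX≈X i j ⟩
  Y i j                ∎
  where
  open ≡-Reasoning
  module HX = IsMoorePenroseInverse hX
  module HY = IsMoorePenroseInverse hY
  -- AX = (AX)ᵀ = (AYAX)ᵀ = AXAY = AY
  AX≈AY : ∀ i j → (A ⊗ X) i j ≡ (A ⊗ Y) i j
  AX≈AY i j = begin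
    (A ⊗ X) i j              ≡⟨ HX.AX-sym i j ⟩
    (A ⊗ X) j i              ≡⟨ sym (⊗-congˡ X HY.AXA≈A j i) ⟩
    (A ⊗ Y ⊗ A ⊗ X) j i      ≡⟨ ⊗-assoc (A ⊗ Y) A X j i ⟩
    (A ⊗ Y ⊗ (A ⊗ X)) j i    ≡⟨ symmetric-swap HY.AX-sym HX.AX-sym j i ⟩
    (A ⊗ X ⊗ (A ⊗ Y)) i j    ≡⟨ sym (⊗-assoc (A ⊗ X) A Y i j) ⟩
    (A ⊗ X ⊗ A ⊗ Y) i j      ≡⟨ ⊗-congˡ Y HX.AXA≈A i j ⟩
    (A ⊗ Y) i j              ∎
  -- XA = XAYA = (YAXA)ᵀ = (YA)ᵀ = YA
  XA≈YA : ∀ i j → (X ⊗ A) i j ≡ (Y ⊗ A) i j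
  XA≈YA i j = begin
    (X ⊗ A) i j              ≡⟨ sym (⊗-congʳ X HY.AXA≈A i j) ⟩
    (X ⊗ (A ⊗ Y ⊗ A)) i j    ≡⟨ ⊗-congʳ X (⊗-assoc A Y A) i j ⟩
    (X ⊗ (A ⊗ (Y ⊗ A))) i j  ≡⟨ sym (⊗-assoc X A (Y ⊗ A) i j) ⟩
    (X ⊗ A ⊗ (Y ⊗ A)) i j    ≡⟨ symmetric-swap HX.XA-sym HY.XA-sym i j ⟩
    (Y ⊗ A ⊗ (X ⊗ A)) j i    ≡⟨ ⊗-assoc Y A (X ⊗ A) j i ⟩
    (Y ⊗ (A ⊗ (X ⊗ A))) j i  ≡⟨ sym (⊗-congʳ Y (⊗-assoc A X A) j i) ⟩
    (Y ⊗ (A ⊗ X ⊗ A)) j i    ≡⟨ ⊗-congʳ Y HX.AXA≈A j i ⟩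
    (Y ⊗ A) j i              ≡⟨ HY.XA-sym j i ⟩
    (Y ⊗ A) i j              ∎

⁺-unique : {A : Matrix m n} {X : Matrix n m} →
           IsMoorePenroseInverse A X → ∀ i j → (A ⁺) i j ≡ X i j
⁺-unique {A = A} = isMoorePenroseInverse-unique (⁺-isMoorePenroseInverse A)

------------------------------------------------------------------------
-- Simple graphs

record SimpleGraph (V : Set) : Set where
  field
    adj        : V → V → Bool
    adj-sym    : ∀ u v → adj u v ≡ adj v u
    adj-irrefl : ∀ v → adj v v ≡ false

open SimpleGraph public

-- A set of (unordered) edges of G, encoded by a symmetric Boolean
-- relation contained in the adjacency relation.
record EdgeSet (G : SimpleGraph V) : Set where
  field
    has     : V → V → Bool
    has-sym : ∀ u v → has u v ≡ has v u
    has⇒adj : ∀ u v → T (has u v) → T (adj G u v)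

open EdgeSet public

infix 4 _≅_

record _≅_ (G : SimpleGraph V) (H : SimpleGraph W) : Set where
  field
    bijection : V ↔ W
    preserves : ∀ u v → adj G u v ≡ adj H (Inverse.to bijection u) (Inverse.to bijection v)

_≡ᵇ_ : Fin n → Fin n → Bool
i ≡ᵇ j = does (i Fin.≟ j)

private
  ≡ᵇ-refl : (i : Fin n) → i ≡ᵇ i ≡ true
  ≡ᵇ-refl i = dec-true (i Fin.≟ i) refl

  ≡ᵇ-sym : (i j : Fin n) → i ≡ᵇ j ≡ j ≡ᵇ i
  ≡ᵇ-sym i j with i Fin.≟ j | j Fin.≟ i
  ... | yes _   | yes _   = refl
  ... | no _    | no _    = refl
  ... | yes i≡j | no j≢i with () ← j≢i (sym i≡j)
  ... | no i≢j  | yes j≡i with () ← i≢j (sym j≡i)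

  consecutive : Fin n → Fin n → Bool
  consecutive i j = does (toℕ j ℕ.≟ suc (toℕ i))

  consecutive-irrefl : (i : Fin n) → consecutive i i ≡ false
  consecutive-irrefl i = dec-false (toℕ i ℕ.≟ suc (toℕ i)) (ℕ.1+n≢n ∘ sym)

K : (n : ℕ) → SimpleGraph (Fin n)
K n = record
  { adj        = λ i j → not (i ≡ᵇ j)
  ; adj-sym    = λ i j → cong not (≡ᵇ-sym i j)
  ; adj-irrefl = λ i → cong not (≡ᵇ-refl i)
  }

P : (n : ℕ) → SimpleGraph (Fin n)
P n = record
  { adj        = λ i j → consecutive i j ∨ consecutive j i
  ; adj-sym    = λ i j → ∨-comm (consecutive i j) (consecutive j i)
  ; adj-irrefl = λ i → cong (λ b → b ∨ b) (consecutive-irrefl i)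
  }

infixr 6 _∪_
infixr 7 _copies_

_∪_ : SimpleGraph V → SimpleGraph W → SimpleGraph (V ⊎ W)
G ∪ H = record
  { adj = λ { (inj₁ u) (inj₁ v) → adj G u v
            ; (inj₂ u) (inj₂ v) → adj H u v
            ; (inj₁ _) (inj₂ _) → false
            ; (inj₂ _) (inj₁ _) → false }
  ; adj-sym = λ { (inj₁ u) (inj₁ v) → adj-sym G u v
                ; (inj₂ u) (inj₂ v) → adj-sym H u v
                ; (inj₁ _) (inj₂ _) → refl
                ; (inj₂ _) (inj₁ _) → refl }
  ; adj-irrefl = λ { (inj₁ v) → adj-irrefl G v
                   ; (inj₂ v) → adj-irrefl H v }
  }

_copies_ : (k : ℕ) → SimpleGraph V → SimpleGraph (Fin k × V)
k copies G = record
  { adj        = λ { (i , u) (j , v) → i ≡ᵇ j ∧ adj G u v }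
  ; adj-sym    = λ { (i , u) (j , v) → cong₂ _∧_ (≡ᵇ-sym i j) (adj-sym G u v) }
  ; adj-irrefl = λ { (i , v) → trans (cong ((i ≡ᵇ i) ∧_) (adj-irrefl G v)) (∧-zeroʳ (i ≡ᵇ i)) }
  }

infixl 6 _─_

_─_ : (G : SimpleGraph V) → EdgeSet G → SimpleGraph V
G ─ F = record
  { adj        = λ u v → adj G u v ∧ not (has F u v)
  ; adj-sym    = λ u v → cong₂ (λ a b → a ∧ not b) (adj-sym G u v) (has-sym F u v)
  ; adj-irrefl = λ v → cong (_∧ not (has F v v)) (adj-irrefl G v)
  }

-- V(F), the union of the edges in F.  The refinement type makes the
-- witness of coverage irrelevant, so a vertex occurs in it only once.
Covered : {G : SimpleGraph V} → EdgeSet G → Set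
Covered {V = V} F = [ v ∈ V ∣ ∃[ u ] T (has F v u) ]

deletionGraph : {G : SimpleGraph V} (F : EdgeSet G) → SimpleGraph (Covered F)
deletionGraph {G = G} F = record
  { adj        = λ u v → has F (value u) (value v)
  ; adj-sym    = λ u v → has-sym F (value u) (value v)
  ; adj-irrefl = λ v → has-irrefl (value v)
  }
  where
  has-irrefl : ∀ v → has F v v ≡ false
  has-irrefl v with has F v v | has⇒adj F v v
  ... | false | _   = refl
  ... | true  | vv with () ← subst T (adj-irrefl G v) (vv _)

SameEdge : (u v x y : V) → Set
SameEdge u v x y = (u ≡ x × v ≡ y) ⊎ (u ≡ y × v ≡ x)

DisjointEdges : (u v x y : V) → Set
DisjointEdges u v x y = u ≢ x × u ≢ y × v ≢ x × v ≢ y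

IsMatching : {G : SimpleGraph V} → EdgeSet G → Set
IsMatching M = ∀ u v x y → T (has M u v) → T (has M x y) →
               ¬ SameEdge u v x y → DisjointEdges u v x y

size : {G : SimpleGraph (Fin n)} → EdgeSet G → ℕ
size F = ℕΣ.sum (λ i → ℕΣ.sum (λ j → if does (i Fin.<? j) ∧ has F i j then 1 else 0))

------------------------------------------------------------------------
-- Kirchhoff index

adjacencyMatrix : SimpleGraph (Fin n) → Matrix n n
adjacencyMatrix G x y = if adj G x y then 1ℚ else 0ℚ

degree : SimpleGraph (Fin n) → Fin n → ℚ
degree G x = sum (adjacencyMatrix G x)

degreeMatrix : SimpleGraph (Fin n) → Matrix n n
degreeMatrix G x y = if x ≡ᵇ y then degree G x else 0ℚ

laplacian : SimpleGraph (Fin n) → Matrix n n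
laplacian G x y = degreeMatrix G x y - adjacencyMatrix G x y

effectiveResistance : SimpleGraph (Fin n) → Fin n → Fin n → ℚ
effectiveResistance G x y =
  (basis x -ᵥ basis y) · (laplacian G ⁺ *ᵥ (basis x -ᵥ basis y))

-- The formula makes sense for every graph; it is the Kirchhoff index when
-- the graph is connected.  Unordered pairs are represented by x < y.
Kf : SimpleGraph (Fin n) → ℚ
Kf G = sum (λ x → sum (λ y → if does (x Fin.<? y) then effectiveResistance G x y else 0ℚ))

------------------------------------------------------------------------
-- Nonvanishing of the denominator

denominator-nonZero : ∀ p {n} → n ℕ.≥ 4 ℕ.⊔ 2 ℕ.* p →
                      ℕ.NonZero ((n ℕ.∸ 1) ℕ.* (n ℕ.∸ 2) ℕ.* (n ℕ.∸ 3))
denominator-nonZero p n≥ = nz (ℕ.≤-trans (ℕ.m≤m⊔n 4 (2 ℕ.* p)) n≥)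
  where
  nz : ∀ {n} → 4 ℕ.≤ n → ℕ.NonZero ((n ℕ.∸ 1) ℕ.* (n ℕ.∸ 2) ℕ.* (n ℕ.∸ 3))
  nz (ℕ.s≤s (ℕ.s≤s (ℕ.s≤s (ℕ.s≤s ℕ.z≤n)))) = _

{-# OPTIONS --safe #-}

-- Write Λ for the Laplacian of the deleted edges, so that K n minus them has
-- Laplacian nI - J - Λ. If the deleted edges form a matching then Λ² = 2Λ,
-- which gives the pseudoinverse qI - q²J + qrΛ with q = 1/n and r = 1/(n-2).
-- Deleting the path a - b - c and k further edges is deleting a matching and
-- then the edge bc: a rank one update of the Laplacian, inverted by the
-- Sherman-Morrison formula. Finally Kf G = n tr L⁺, because L⁺ annihilates
-- the constant vectors.

module Submission where

open import Defs
open import Algebra.Bundles using (CommutativeRing)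
open import Data.Bool.Base using (Bool; true; false; T; not; _∧_; _∨_; if_then_else_)
open import Data.Bool.Properties using (T?; ∨-comm)
open import Data.Empty using (⊥; ⊥-elim)
open import Data.Fin.Base as Fin using (Fin; zero; suc)
open import Data.Fin.Patterns using (0F; 1F; 2F)
import Data.Fin.Properties as Fin
open import Data.Integer.Base as ℤ using (+_)
import Data.Integer.Properties as ℤ
import Data.Irrelevant as Irrelevant
open import Data.Nat.Base as ℕ using (ℕ; zero; suc; _≥_; _⊔_; _∸_)
import Data.Nat.Properties as ℕ
open import Data.Product.Base using (_×_; _,_; proj₁; proj₂; ∃-syntax)
open import Data.Rational.Base hiding (_≥_; _⊔_)
open import Data.Rational.Properties
open import Data.Rational.Solver using (module +-*-Solver)
import Data.Rational.Unnormalised.Base as ℚᵘ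
import Data.Rational.Unnormalised.Properties as ℚᵘ
open import Data.Refinement using (value; value-injective; _,_)
open import Data.Sum.Base using (_⊎_; inj₁; inj₂)
open import Data.Sum.Function.Propositional using (_⊎-↔_)
open import Data.Unit.Base using (tt)
open import Data.Vec.Functional using (Vector)
open import Function.Base using (_∘_; case_of_)
open import Function.Bundles using (_↔_; Inverse)
open import Function.Construct.Composition using (_↔-∘_)
open import Function.Construct.Identity using (↔-id)
open import Relation.Binary.Definitions using (tri<; tri≈; tri>)
open import Relation.Binary.PropositionalEquality
open import Relation.Nullary using (does; yes; no)
open import Relation.Nullary.Decidable using (dec-true; dec-false; decidable-stable)
open import Algebra.Properties.Semiring.Sum
  (CommutativeRing.semiring +-*-commutativeRing)
  using (sum; ∑-distrib-+; ∑-comm; *-distribˡ-sum; *-distribʳ-sum; sum-cong-≗; sum-replicate-zero)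
import Algebra.Properties.CommutativeMonoid.Sum ℕ.+-0-commutativeMonoid as ℕΣ

open +-*-Solver using (solve; con; _:=_; _:+_; _:*_; _:-_; :-_)

-- On the vectors orthogonal to `𝟏` the Laplacian acts as `n - Λ`, and for a matching `Λ` has no
-- eigenvalues other than 0 and 2. Interpolating `1/(n - Λ)` at these two values gives `q + q r Λ`,
-- which is where `r = 1/(n-2)` comes from; the term `- q²J` makes the inverse annihilate `𝟏`. The
-- proof itself uses no spectral theory: each inverse is written down and verified by
-- multiplication. Removing the edge `bc` from the path leaves a matching `Λ′` with one edge fewer
-- than `M`, so the number of edges cancels from the difference. With `v = e_b - e_c` one has
-- `Λ′ v = e_b - e_a`, so the update takes place in a plane, and its denominator is
-- `1 - q (2 + r) = (n-1)(n-3) / (n (n-2))`. The factors `n-1` and `n-3` reflect the nonzero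
-- Laplacian eigenvalues 1 and 3 of the path. Until the final assembly, reciprocals are variables
-- constrained by equations such as `q * N ≡ 1ℚ`, so the scalar steps become polynomial identities.

private variable
  m n : ℕ

-- Natural numbers as rationals

2ℚ : ℚ
2ℚ = 1ℚ + 1ℚ

ι : ℕ → ℚ
ι n = + n / 1

-- Normalisation hides numerator and denominator in `ℚ`; over the unnormalised rationals only a
-- cross multiplication is left.
/-*-cancel : ∀ a b .{{_ : ℕ.NonZero b}} → + a / b * ι b ≡ ι a
/-*-cancel a b@(suc _) = toℚᵘ-injective (begin-equality
  toℚᵘ (+ a / b * ι b)            ≃⟨ toℚᵘ-homo-* (+ a / b) (ι b) ⟩
  toℚᵘ (+ a / b) ℚᵘ.* toℚᵘ (ι b)  ≃⟨ ℚᵘ.*-cong (toℚᵘ-fromℚᵘ (+ a ℚᵘ./ b)) (toℚᵘ-fromℚᵘ (+ b ℚᵘ./ 1)) ⟩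
  + a ℚᵘ./ b ℚᵘ.* (+ b ℚᵘ./ 1)    ≃⟨ ℚᵘ.*≡* (trans (ℤ.*-identityʳ (+ a ℤ.* + b))
                                             (cong (λ z → + a ℤ.* + z) (sym (ℕ.*-identityʳ b)))) ⟩
  + a ℚᵘ./ 1                      ≃⟨ toℚᵘ-fromℚᵘ (+ a ℚᵘ./ 1) ⟨
  toℚᵘ (ι a)                      ∎)
  where open ℚᵘ.≤-Reasoning

ι-+ : ∀ m n → ι (m ℕ.+ n) ≡ ι m + ι n
ι-+ m n = toℚᵘ-injective (begin-equality
  toℚᵘ (ι (m ℕ.+ n))              ≃⟨ toℚᵘ-fromℚᵘ (+ (m ℕ.+ n) ℚᵘ./ 1) ⟩
  + (m ℕ.+ n) ℚᵘ./ 1              ≃⟨ ℚᵘ.*≡* (cong (ℤ._* + 1) (sym (cong₂ ℤ._+_ (ℤ.*-identityʳ (+ m)) (ℤ.*-identityʳ (+ n))))) ⟩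
  + m ℚᵘ./ 1 ℚᵘ.+ (+ n ℚᵘ./ 1)    ≃⟨ ℚᵘ.+-cong (toℚᵘ-fromℚᵘ (+ m ℚᵘ./ 1)) (toℚᵘ-fromℚᵘ (+ n ℚᵘ./ 1)) ⟨
  toℚᵘ (ι m) ℚᵘ.+ toℚᵘ (ι n)      ≃⟨ toℚᵘ-homo-+ (ι m) (ι n) ⟨
  toℚᵘ (ι m + ι n)                ∎)
  where open ℚᵘ.≤-Reasoning

open ≡-Reasoning

ι-* : ∀ m n → ι (m ℕ.* n) ≡ ι m * ι n
ι-* zero    n = sym (*-zeroˡ (ι n))
ι-* (suc m) n = begin
  ι (n ℕ.+ m ℕ.* n)        ≡⟨ ι-+ n (m ℕ.* n) ⟩
  ι n + ι (m ℕ.* n)        ≡⟨ cong (λ z → ι n + z) (ι-* m n) ⟩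
  ι n + ι m * ι n          ≡⟨ solve 2 (λ m n → n :+ m :* n := (con 1ℚ :+ m) :* n) refl (ι m) (ι n) ⟩
  (1ℚ + ι m) * ι n         ≡⟨ cong (_* ι n) (sym (ι-+ 1 m)) ⟩
  ι (suc m) * ι n          ∎

ι-suc-nonZero : ∀ n → NonZero (ι (suc n))
ι-suc-nonZero n = pos⇒nonZero (ι (suc n)) {{normalize-pos (suc n) 1}}

-- Vectors

𝟏 : Vector ℚ n
𝟏 _ = 1ℚ

-- A common shape for the rows of the Laplacian, of its pseudoinverse, of the adjacency matrix and
-- of the resistance matrix, so that one rule for sums and one for products serve them all.
lin₃ : (s t r : ℚ) (u v w : Vector ℚ n) → Vector ℚ n
lin₃ s t r u v w i = s * u i + t * v i + r * w i

·-comm : (u v : Vector ℚ n) → u · v ≡ v · u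
·-comm u v = sum-cong-≗ (λ i → *-comm (u i) (v i))

·-congˡ : {u v : Vector ℚ n} (w : Vector ℚ n) → u ≗ v → u · w ≡ v · w
·-congˡ w eq = sum-cong-≗ (λ i → cong (_* w i) (eq i))

·-congʳ : (w : Vector ℚ n) {u v : Vector ℚ n} → u ≗ v → w · u ≡ w · v
·-congʳ w eq = sum-cong-≗ (λ i → cong (w i *_) (eq i))

sum≡·𝟏 : (u : Vector ℚ n) → sum u ≡ u · 𝟏
sum≡·𝟏 u = sum-cong-≗ (λ i → sym (*-identityʳ (u i)))

sum-lin₂ : (s t : ℚ) (u v : Vector ℚ n) → sum (λ i → s * u i + t * v i) ≡ s * sum u + t * sum v
sum-lin₂ {n} s t u v = trans (∑-distrib-+ {n} (λ i → s * u i) (λ i → t * v i))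
  (sym (cong₂ _+_ (*-distribˡ-sum s u) (*-distribˡ-sum t v)))

sum-lin₃ : (s t r : ℚ) (u v w : Vector ℚ n) → sum (lin₃ s t r u v w) ≡ s * sum u + t * sum v + r * sum w
sum-lin₃ {n} s t r u v w = trans (∑-distrib-+ {n} (λ i → s * u i + t * v i) (λ i → r * w i))
  (cong₂ _+_ (sum-lin₂ s t u v) (sym (*-distribˡ-sum r w)))

lin₃-· : (s t r : ℚ) (u v w z : Vector ℚ n) → lin₃ s t r u v w · z ≡ s * (u · z) + t * (v · z) + r * (w · z)
lin₃-· s t r u v w z = trans
  (sum-cong-≗ (λ i → solve 7 (λ s t r u v w z →
     (s :* u :+ t :* v :+ r :* w) :* z := s :* (u :* z) :+ t :* (v :* z) :+ r :* (w :* z)) refl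
     s t r (u i) (v i) (w i) (z i)))
  (sum-lin₃ s t r (λ i → u i * z i) (λ i → v i * z i) (λ i → w i * z i))

·-lin₃ : (s t r : ℚ) (z u v w : Vector ℚ n) → z · lin₃ s t r u v w ≡ s * (z · u) + t * (z · v) + r * (z · w)
·-lin₃ s t r z u v w = begin
  z · lin₃ s t r u v w                         ≡⟨ ·-comm z _ ⟩
  lin₃ s t r u v w · z                         ≡⟨ lin₃-· s t r u v w z ⟩
  s * (u · z) + t * (v · z) + r * (w · z)
    ≡⟨ cong₂ _+_ (cong₂ (λ x y → s * x + t * y) (·-comm u z) (·-comm v z)) (cong (r *_) (·-comm w z)) ⟩
  s * (z · u) + t * (z · v) + r * (z · w)      ∎

sum-0 : {u : Vector ℚ n} → (∀ i → u i ≡ 0ℚ) → sum u ≡ 0ℚ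
sum-0 {n} eq = trans (sum-cong-≗ eq) (sum-replicate-zero n)

basis-· : (x : Fin n) (v : Vector ℚ n) → basis x · v ≡ v x
basis-· {suc n} zero v = trans
  (cong₂ _+_ (*-identityˡ (v zero)) (sum-0 (λ i → *-zeroˡ (v (suc i)))))
  (+-identityʳ (v zero))
basis-· {suc n} (suc x) v = trans
  (cong₂ _+_ (*-zeroˡ (v zero)) (basis-· x (v ∘ suc)))
  (+-identityˡ (v (suc x)))

basis-yes : {x y : Fin n} → y ≡ x → basis x y ≡ 1ℚ
basis-yes {x = x} {y} eq = cong (if_then 1ℚ else 0ℚ) (dec-true (y Fin.≟ x) eq)

basis-no : {x y : Fin n} → y ≢ x → basis x y ≡ 0ℚ
basis-no {x = x} {y} neq = cong (if_then 1ℚ else 0ℚ) (dec-false (y Fin.≟ x) neq)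

basis-sym : Symmetric {n} basis
basis-sym x y with x Fin.≟ y
... | yes x≡y = basis-yes (sym x≡y)
... | no  x≢y = basis-no (x≢y ∘ sym)

basis-*-cong : (f : Fin n → ℚ) (x y : Fin n) → basis x y * f x ≡ basis x y * f y
basis-*-cong f x y with y Fin.≟ x
... | yes refl = refl
... | no  _    = trans (*-zeroˡ (f x)) (sym (*-zeroˡ (f y)))

sum-basis : (x : Fin n) → sum (basis x) ≡ 1ℚ
sum-basis x = trans (sum≡·𝟏 (basis x)) (basis-· x 𝟏)

ᵥ*-·-assoc : (u : Vector ℚ m) (A : Matrix m n) (v : Vector ℚ n) → (u ᵥ* A) · v ≡ u · (A *ᵥ v)
ᵥ*-·-assoc {m} {n} u A v = begin
  sum (λ j → sum (λ i → u i * A i j) * v j)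
    ≡⟨ sum-cong-≗ (λ j → trans (*-comm _ (v j)) (*-distribˡ-sum {m} (v j) (λ i → u i * A i j))) ⟩
  sum (λ j → sum (λ i → v j * (u i * A i j)))
    ≡⟨ ∑-comm {n} {m} (λ j i → v j * (u i * A i j)) ⟩
  sum (λ i → sum (λ j → v j * (u i * A i j)))
    ≡⟨ sum-cong-≗ (λ i → sum-cong-≗ {n} (λ j →
         solve 3 (λ u a v → v :* (u :* a) := u :* (a :* v)) refl (u i) (A i j) (v j))) ⟩
  sum (λ i → sum (λ j → u i * (A i j * v j)))
    ≡⟨ sum-cong-≗ (λ i → sym (*-distribˡ-sum {n} (u i) (λ j → A i j * v j))) ⟩
  sum (λ i → u i * sum (λ j → A i j * v j)) ∎

sum-𝟏 : ∀ n → sum {n} 𝟏 ≡ ι n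
sum-𝟏 zero    = refl
sum-𝟏 (suc n) = trans (cong (λ z → 1ℚ + z) (sum-𝟏 n)) (sym (ι-+ 1 n))

-- Laplacians and their pseudoinverses

trace : Matrix n n → ℚ
trace A = sum (λ x → A x x)

-- X inverts the Laplacian L on the hyperplane orthogonal to 𝟏; q = 1/n, so
-- L X is the orthogonal projection onto that hyperplane.
record IsLaplacianInverse (q : ℚ) (L X : Matrix n n) : Set where
  field
    L-sym : Symmetric L
    X-sym : Symmetric X
    L𝟏≡0  : ∀ x → sum (L x) ≡ 0ℚ
    X𝟏≡0  : ∀ x → sum (X x) ≡ 0ℚ
    LX    : ∀ x y → (L ⊗ X) x y ≡ basis x y - q

  LX*ᵥ : (v : Vector ℚ n) → sum v ≡ 0ℚ → ∀ x → (L *ᵥ (X *ᵥ v)) x ≡ v x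
  LX*ᵥ v v0 x = begin
    L x · (X *ᵥ v)                                  ≡⟨ sym (ᵥ*-·-assoc (L x) X v) ⟩
    (λ y → (L ⊗ X) x y) · v                         ≡⟨ sum-cong-≗ (λ y → cong (_* v y) (LX x y)) ⟩
    (λ y → basis x y - q) · v                       ≡⟨ sum-cong-≗ (λ y →
      solve 3 (λ b q v → (b :- q) :* v := con 1ℚ :* (b :* v) :+ (:- q) :* v) refl (basis x y) q (v y)) ⟩
    sum (λ y → 1ℚ * (basis x y * v y) + (- q) * v y)
      ≡⟨ sum-lin₂ 1ℚ (- q) (λ y → basis x y * v y) v ⟩
    1ℚ * (basis x · v) + (- q) * sum v
      ≡⟨ cong₂ (λ s t → 1ℚ * s + (- q) * t) (basis-· x v) v0 ⟩
    1ℚ * v x + (- q) * 0ℚ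
      ≡⟨ solve 2 (λ v q → con 1ℚ :* v :+ (:- q) :* con 0ℚ := v) refl (v x) q ⟩
    v x                                             ∎

  LX-sym : Symmetric (L ⊗ X)
  LX-sym x y = trans (LX x y) (trans (cong (_- q) (basis-sym x y)) (sym (LX y x)))

  -- By symmetry of both factors `X ⊗ L` is the transpose of `L ⊗ X`, and the latter is symmetric,
  -- being a projection of known entries.
  XL≡LX : ∀ x y → (X ⊗ L) x y ≡ (L ⊗ X) x y
  XL≡LX x y = begin
    X x · (λ j → L j y)
      ≡⟨ sum-cong-≗ (λ j → trans (*-comm (X x j) (L j y)) (cong₂ _*_ (L-sym j y) (X-sym x j))) ⟩
    (L ⊗ X) y x          ≡⟨ LX-sym y x ⟩
    (L ⊗ X) x y          ∎

  -- The columns of `A` are orthogonal to `𝟏`, so the projection `P` fixes them. With `A = L` and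
  -- `A = X` this gives the first two Penrose equations.
  projection-⊗ : {P A : Matrix n n} → (∀ x y → P x y ≡ basis x y - q) → Symmetric A →
                 (∀ x → sum (A x) ≡ 0ℚ) → ∀ x y → (P ⊗ A) x y ≡ A x y
  projection-⊗ {P} {A} P≡ A-sym A0 x y = begin
    P x · (λ j → A j y)
      ≡⟨ sum-cong-≗ (λ j → cong (_* A j y) (P≡ x j)) ⟩
    (λ j → basis x j - q) · (λ j → A j y)              ≡⟨ sum-cong-≗ (λ j →
      solve 3 (λ b q v → (b :- q) :* v := con 1ℚ :* (b :* v) :+ (:- q) :* v) refl (basis x j) q (A j y)) ⟩
    sum (λ j → 1ℚ * (basis x j * A j y) + (- q) * A j y)
      ≡⟨ sum-lin₂ 1ℚ (- q) (λ j → basis x j * A j y) (λ j → A j y) ⟩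
    1ℚ * (basis x · (λ j → A j y)) + (- q) * sum (λ j → A j y)
      ≡⟨ cong₂ (λ s t → 1ℚ * s + (- q) * t)
           (basis-· x (λ j → A j y)) (trans (sum-cong-≗ (λ j → A-sym j y)) (A0 y)) ⟩
    1ℚ * A x y + (- q) * 0ℚ
      ≡⟨ solve 2 (λ v q → con 1ℚ :* v :+ (:- q) :* con 0ℚ := v) refl (A x y) q ⟩
    A x y                                              ∎

  isMoorePenroseInverse : IsMoorePenroseInverse L X
  isMoorePenroseInverse = record
    { AXA≈A  = projection-⊗ LX L-sym L𝟏≡0
    ; XAX≈X  = projection-⊗ (λ x y → trans (XL≡LX x y) (LX x y)) X-sym X𝟏≡0
    ; AX-sym = LX-sym
    ; XA-sym = λ x y → trans (XL≡LX x y) (trans (LX-sym x y) (sym (XL≡LX y x)))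
    }

IsLaplacianInverse-congˡ : {q : ℚ} {L L′ X : Matrix n n} → (∀ x y → L x y ≡ L′ x y) →
  IsLaplacianInverse q L X → IsLaplacianInverse q L′ X
IsLaplacianInverse-congˡ {X = X} eq inv = record
  { L-sym = λ x y → trans (sym (eq x y)) (trans (L-sym x y) (eq y x))
  ; X-sym = X-sym
  ; L𝟏≡0  = λ x → trans (sum-cong-≗ (λ y → sym (eq x y))) (L𝟏≡0 x)
  ; X𝟏≡0  = X𝟏≡0
  ; LX    = λ x y → trans (·-congˡ (λ j → X j y) (λ j → sym (eq x j))) (LX x y)
  }
  where open IsLaplacianInverse inv

-- Sherman-Morrison
rankOneUpdate : {q s : ℚ} {L X : Matrix n n} → IsLaplacianInverse q L X →
  (v : Vector ℚ n) → sum v ≡ 0ℚ → s * (1ℚ - v · (X *ᵥ v)) ≡ 1ℚ →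
  IsLaplacianInverse q (λ x y → L x y - v x * v y) (λ x y → X x y + s * ((X *ᵥ v) x * (X *ᵥ v) y))
rankOneUpdate {n} {q} {s} {L} {X} inv v v0 hs = record
  { L-sym = λ x y → cong₂ _-_ (L-sym x y) (*-comm (v x) (v y))
  ; X-sym = λ x y → cong₂ (λ a b → a + s * b) (X-sym x y) (*-comm (w x) (w y))
  ; L𝟏≡0  = λ x → begin
      sum (λ y → L x y - v x * v y)
        ≡⟨ sum-cong-≗ (λ y → solve 3 (λ l a b →
             l :- a :* b := con 1ℚ :* l :+ (:- a) :* b) refl (L x y) (v x) (v y)) ⟩
      sum (λ y → 1ℚ * L x y + (- v x) * v y)  ≡⟨ sum-lin₂ 1ℚ (- v x) (L x) v ⟩
      1ℚ * sum (L x) + (- v x) * sum v ≡⟨ cong₂ (λ a b → 1ℚ * a + (- v x) * b) (L𝟏≡0 x) v0 ⟩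
      1ℚ * 0ℚ + (- v x) * 0ℚ
        ≡⟨ solve 1 (λ a → con 1ℚ :* con 0ℚ :+ a :* con 0ℚ := con 0ℚ) refl (- v x) ⟩
      0ℚ ∎
  ; X𝟏≡0  = λ x → begin
      sum (λ y → X x y + s * (w x * w y))
        ≡⟨ sum-cong-≗ (λ y → solve 4 (λ l s a b →
             l :+ s :* (a :* b) := con 1ℚ :* l :+ (s :* a) :* b) refl (X x y) s (w x) (w y)) ⟩
      sum (λ y → 1ℚ * X x y + (s * w x) * w y)  ≡⟨ sum-lin₂ 1ℚ (s * w x) (X x) w ⟩
      1ℚ * sum (X x) + (s * w x) * sum w ≡⟨ cong₂ (λ a b → 1ℚ * a + (s * w x) * b) (X𝟏≡0 x) w0 ⟩
      1ℚ * 0ℚ + (s * w x) * 0ℚ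
        ≡⟨ solve 1 (λ a → con 1ℚ :* con 0ℚ :+ a :* con 0ℚ := con 0ℚ) refl (s * w x) ⟩
      0ℚ ∎
  ; LX    = LX′
  }
  where
  open IsLaplacianInverse inv
  w : Vector ℚ n
  w = X *ᵥ v
  -- `X` is symmetric and annihilates `𝟏`, so its image is orthogonal to `𝟏`; this lets the updated
  -- inverse annihilate `𝟏` as well.
  w0 : sum w ≡ 0ℚ
  w0 = begin
    sum w              ≡⟨ sum≡·𝟏 w ⟩
    w · 𝟏              ≡⟨ ·-comm w 𝟏 ⟩
    𝟏 · (X *ᵥ v)       ≡⟨ sym (ᵥ*-·-assoc 𝟏 X v) ⟩
    (𝟏 ᵥ* X) · v
      ≡⟨ sum-0 (λ y → trans
           (cong (_* v y) (trans (sum-cong-≗ (λ x → trans (*-identityˡ (X x y)) (X-sym x y))) (X𝟏≡0 y)))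
           (*-zeroˡ (v y))) ⟩
    0ℚ                 ∎
  X-col·v : ∀ y → v · (λ j → X j y) ≡ w y
  X-col·v y = sum-cong-≗ (λ j → trans (*-comm (v j) (X j y)) (cong (_* v j) (X-sym j y)))
  update-· : ∀ u y → u · (λ j → X j y + s * (w j * w y)) ≡ u · (λ j → X j y) + s * w y * (u · w)
  update-· u y = begin
    u · (λ j → X j y + s * (w j * w y))
      ≡⟨ sum-cong-≗ (λ j → solve 5 (λ u a s b c →
           u :* (a :+ s :* (b :* c))
           := con 1ℚ :* (u :* a) :+ (s :* c) :* (u :* b)) refl (u j) (X j y) s (w j) (w y)) ⟩
    sum (λ j → 1ℚ * (u j * X j y) + (s * w y) * (u j * w j))
      ≡⟨ sum-lin₂ 1ℚ (s * w y) (λ j → u j * X j y) (λ j → u j * w j) ⟩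
    1ℚ * (u · (λ j → X j y)) + (s * w y) * (u · w)
      ≡⟨ cong (_+ (s * w y) * (u · w)) (*-identityˡ (u · (λ j → X j y))) ⟩
    u · (λ j → X j y) + s * w y * (u · w) ∎
  LX′ : ∀ x y → (λ j → L x j - v x * v j) · (λ j → X j y + s * (w j * w y)) ≡ basis x y - q
  LX′ x y = begin
    (λ j → L x j - v x * v j) · Xy
      ≡⟨ sum-cong-≗ (λ j → solve 4 (λ l a b c →
           (l :- a :* b) :* c
           := con 1ℚ :* (l :* c) :+ (:- a) :* (b :* c)) refl (L x j) (v x) (v j) (Xy j)) ⟩
    sum (λ j → 1ℚ * (L x j * Xy j) + (- v x) * (v j * Xy j))
      ≡⟨ sum-lin₂ 1ℚ (- v x) (λ j → L x j * Xy j) (λ j → v j * Xy j) ⟩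
    1ℚ * (L x · Xy) + (- v x) * (v · Xy)
      ≡⟨ cong₂ (λ a b → 1ℚ * a + (- v x) * b) (update-· (L x) y) (update-· v y) ⟩
    1ℚ * ((L ⊗ X) x y + s * w y * (L x · w)) + (- v x) * (v · (λ j → X j y) + s * w y * (v · w))
      ≡⟨ cong₂ (λ a b → 1ℚ * (a + s * w y * b) + (- v x) * (v · (λ j → X j y) + s * w y * (v · w)))
           (LX x y) (LX*ᵥ v v0 x) ⟩
    1ℚ * (basis x y - q + s * w y * v x) + (- v x) * (v · (λ j → X j y) + s * w y * (v · w))
      ≡⟨ cong (λ a → 1ℚ * (basis x y - q + s * w y * v x) + (- v x) * (a + s * w y * (v · w)))
           (X-col·v y) ⟩
    1ℚ * (basis x y - q + s * w y * v x) + (- v x) * (w y + s * w y * (v · w))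
      -- All rank one terms are multiples of `v x * w y`; their total coefficient is
      -- `s * (1ℚ - v · w) - 1ℚ`, which the choice of `s` makes zero.
      ≡⟨ solve 5 (λ d s w v k →
           con 1ℚ :* (d :+ s :* w :* v) :+ (:- v) :* (w :+ s :* w :* k)
           := d :+ v :* w :* (s :* (con 1ℚ :- k) :- con 1ℚ)) refl
           (basis x y - q) s (w y) (v x) (v · w) ⟩
    (basis x y - q) + v x * w y * (s * (1ℚ - v · w) - 1ℚ)
      ≡⟨ cong (λ z → (basis x y - q) + v x * w y * (z - 1ℚ)) hs ⟩
    (basis x y - q) + v x * w y * (1ℚ - 1ℚ)
      ≡⟨ solve 2 (λ d a → d :+ a :* (con 1ℚ :- con 1ℚ) := d) refl (basis x y - q) (v x * w y) ⟩
    basis x y - q ∎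
    where
    Xy : Vector ℚ n
    Xy j = X j y + s * (w j * w y)

-- The Kirchhoff index as a trace

pairSum : Matrix n n → ℚ
pairSum f = sum (λ x → sum (λ y → if does (x Fin.<? y) then f x y else 0ℚ))

-- Sums over all ordered pairs are easier to evaluate than sums over `x < y`. Needed for the
-- Kirchhoff index and again for counting the edges of a matching.
pairSum-double : (f : Matrix n n) → Symmetric f → (∀ x → f x x ≡ 0ℚ) →
                 pairSum f + pairSum f ≡ sum (λ x → sum (f x))
pairSum-double {n} f f-sym f0 = sym (begin
  sum (λ x → sum (f x))
    ≡⟨ sum-cong-≗ (λ x → sum-cong-≗ (split x)) ⟩
  sum (λ x → sum (λ y → g x y + g y x))
    ≡⟨ sum-cong-≗ (λ x → ∑-distrib-+ {n} (g x) (λ y → g y x)) ⟩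
  sum (λ x → sum (g x) + sum (λ y → g y x))
    ≡⟨ ∑-distrib-+ {n} (λ x → sum (g x)) (λ x → sum (λ y → g y x)) ⟩
  pairSum f + sum (λ x → sum (λ y → g y x))
    ≡⟨ cong (λ z → pairSum f + z) (∑-comm {n} {n} (λ x y → g y x)) ⟩
  pairSum f + pairSum f                                    ∎)
  where
  g : Matrix n n
  g x y = if does (x Fin.<? y) then f x y else 0ℚ
  split : ∀ x y → f x y ≡ g x y + g y x
  split x y with Fin.<-cmp x y
  ... | tri< x<y _ x≯y rewrite dec-true (x Fin.<? y) x<y | dec-false (y Fin.<? x) x≯y =
    sym (+-identityʳ (f x y))
  ... | tri> x≮y _ x>y rewrite dec-false (x Fin.<? y) x≮y | dec-true (y Fin.<? x) x>y =
    trans (f-sym x y) (sym (+-identityˡ (f y x)))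
  ... | tri≈ x≮y refl _ rewrite dec-false (x Fin.<? x) x≮y = trans (f0 x) (sym (+-identityˡ 0ℚ))

double-injective : {p q : ℚ} → p + p ≡ q + q → p ≡ q
double-injective {p} {q} eq = begin
  p            ≡⟨ solve 1 (λ p → p := con ½ :* (p :+ p)) refl p ⟩
  ½ * (p + p)  ≡⟨ cong (½ *_) eq ⟩
  ½ * (q + q)  ≡⟨ solve 1 (λ p → con ½ :* (p :+ p) := p) refl q ⟩
  q            ∎

difference-· : (x y : Fin n) (w : Vector ℚ n) → (basis x -ᵥ basis y) · w ≡ w x - w y
difference-· x y w = begin
  (basis x -ᵥ basis y) · w ≡⟨ sum-cong-≗ (λ j →
    solve 3 (λ a b v → (a :- b) :* v := con 1ℚ :* (a :* v) :+ con (- 1ℚ) :* (b :* v)) refl (basis x j) (basis y j) (w j)) ⟩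
  sum (λ j → 1ℚ * (basis x j * w j) + (- 1ℚ) * (basis y j * w j))
    ≡⟨ sum-lin₂ 1ℚ (- 1ℚ) (λ j → basis x j * w j) (λ j → basis y j * w j) ⟩
  1ℚ * (basis x · w) + (- 1ℚ) * (basis y · w)
    ≡⟨ cong₂ (λ s t → 1ℚ * s + (- 1ℚ) * t) (basis-· x w) (basis-· y w) ⟩
  1ℚ * w x + (- 1ℚ) * w y
    ≡⟨ solve 2 (λ a b → con 1ℚ :* a :+ con (- 1ℚ) :* b := a :- b) refl (w x) (w y) ⟩
  w x - w y ∎

difference-quadratic : (X : Matrix n n) (x y : Fin n) →
  (basis x -ᵥ basis y) · (X *ᵥ (basis x -ᵥ basis y)) ≡ (X x x - X x y) - (X y x - X y y)
difference-quadratic X x y = trans (difference-· x y (X *ᵥ (basis x -ᵥ basis y))) (cong₂ _-_ (row x) (row y))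
  where
  row : ∀ z → (X *ᵥ (basis x -ᵥ basis y)) z ≡ X z x - X z y
  row z = trans (·-comm (X z) (basis x -ᵥ basis y)) (difference-· x y (X z))

Kf≡n*trace : {q : ℚ} {X : Matrix n n} (G : SimpleGraph (Fin n)) →
             IsLaplacianInverse q (laplacian G) X → Kf G ≡ ι n * trace X
Kf≡n*trace {n} {X = X} G inv = double-injective (begin
  Kf G + Kf G                                         ≡⟨ cong (λ z → z + z) Kf≡pairSum ⟩
  pairSum R + pairSum R                               ≡⟨ pairSum-double R R-sym R-diag ⟩
  sum (λ x → sum (R x))                               ≡⟨ sum-cong-≗ row ⟩
  sum (λ x → ι n * X x x + trace X * 1ℚ)              ≡⟨ sum-lin₂ (ι n) (trace X) (λ x → X x x) 𝟏 ⟩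
  ι n * trace X + trace X * sum {n} 𝟏
    ≡⟨ cong (λ z → ι n * trace X + z)
         (trans (cong (trace X *_) (sum-𝟏 n)) (*-comm (trace X) (ι n))) ⟩
  ι n * trace X + ι n * trace X                       ∎)
  where
  open IsLaplacianInverse inv
  -- The resistance `X x x - 2 X x y + X y y`, arranged as a combination of vectors in `y`: summing
  -- over `y` leaves `n X x x + trace X`, because the mixed term sums to zero.
  R : Matrix n n
  R x y = lin₃ (X x x) (- 2ℚ) 1ℚ 𝟏 (X x) (λ y → X y y) y
  R-sym : Symmetric R
  R-sym x y = trans (cong (λ z → X x x * 1ℚ + (- 2ℚ) * z + 1ℚ * X y y) (X-sym x y))
    (solve 3 (λ a b c → a :* con 1ℚ :+ con (- 2ℚ) :* b :+ con 1ℚ :* c := c :* con 1ℚ :+ con (- 2ℚ) :* b :+ con 1ℚ :* a) refl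
      (X x x) (X y x) (X y y))
  R-diag : ∀ x → R x x ≡ 0ℚ
  R-diag x = solve 1 (λ a → a :* con 1ℚ :+ con (- 2ℚ) :* a :+ con 1ℚ :* a := con 0ℚ) refl (X x x)
  R≡ : ∀ x y → effectiveResistance G x y ≡ R x y
  R≡ x y = begin
    effectiveResistance G x y
      -- `_⁺` is abstract, so the explicit `X` can replace it only through uniqueness.
      ≡⟨ ·-congʳ (basis x -ᵥ basis y) (λ i → ·-congˡ (basis x -ᵥ basis y) (⁺-unique isMoorePenroseInverse i)) ⟩
    (basis x -ᵥ basis y) · (X *ᵥ (basis x -ᵥ basis y)) ≡⟨ difference-quadratic X x y ⟩
    (X x x - X x y) - (X y x - X y y) ≡⟨ cong (λ z → (X x x - X x y) - (z - X y y)) (X-sym y x) ⟩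
    (X x x - X x y) - (X x y - X y y)
      ≡⟨ solve 3 (λ a b c →
           (a :- b) :- (b :- c)
           := a :* con 1ℚ :+ con (- 2ℚ) :* b :+ con 1ℚ :* c) refl (X x x) (X x y) (X y y) ⟩
    R x y ∎
  Kf≡pairSum : Kf G ≡ pairSum R
  Kf≡pairSum = sum-cong-≗ (λ x → sum-cong-≗ (λ y → cong (if does (x Fin.<? y) then_else 0ℚ) (R≡ x y)))
  row : ∀ x → sum (R x) ≡ ι n * X x x + trace X * 1ℚ
  row x = begin
    sum (R x) ≡⟨ sum-lin₃ (X x x) (- 2ℚ) 1ℚ 𝟏 (X x) (λ y → X y y) ⟩
    X x x * sum {n} 𝟏 + (- 2ℚ) * sum (X x) + 1ℚ * trace X
      ≡⟨ cong₂ (λ s t → X x x * s + (- 2ℚ) * t + 1ℚ * trace X) (sum-𝟏 n) (X𝟏≡0 x) ⟩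
    X x x * ι n + (- 2ℚ) * 0ℚ + 1ℚ * trace X
      ≡⟨ solve 3 (λ a n t →
           a :* n :+ con (- 2ℚ) :* con 0ℚ :+ con 1ℚ :* t
           := n :* a :+ t :* con 1ℚ) refl (X x x) (ι n) (trace X) ⟩
    ι n * X x x + trace X * 1ℚ ∎

-- Deleting a matching

⟦_⟧ : (Fin n → Fin n → Bool) → Matrix n n
⟦ R ⟧ x y = if R x y then 1ℚ else 0ℚ

⟦⟧-true : (R : Fin n → Fin n → Bool) {x y : Fin n} → T (R x y) → ⟦ R ⟧ x y ≡ 1ℚ
⟦⟧-true R {x} {y} t with R x y
... | true = refl

⟦⟧-false : (R : Fin n → Fin n → Bool) {x y : Fin n} → (T (R x y) → ⊥) → ⟦ R ⟧ x y ≡ 0ℚ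
⟦⟧-false R {x} {y} f with R x y
... | true  = ⊥-elim (f tt)
... | false = refl

deg : (Fin n → Fin n → Bool) → Vector ℚ n
deg R x = sum (⟦ R ⟧ x)

Λ : (Fin n → Fin n → Bool) → Matrix n n
Λ R x y = basis x y * deg R x - ⟦ R ⟧ x y

-- The matrix `sI + tJ + rA`. Both `nI - J - Λ` and its pseudoinverse have this form.
comb : (s t r : ℚ) → Matrix n n → Matrix n n
comb s t r A x = lin₃ s t r (basis x) 𝟏 (A x)

comb-*ᵥ : (s t r : ℚ) (A : Matrix n n) (v : Vector ℚ n) (x : Fin n) →
          (comb s t r A *ᵥ v) x ≡ s * v x + t * sum v + r * (A *ᵥ v) x
comb-*ᵥ s t r A v x = trans (lin₃-· s t r (basis x) 𝟏 (A x) v)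
  (cong₂ (λ a b → s * a + t * b + r * (A x · v)) (basis-· x v) (trans (·-comm 𝟏 v) (sym (sum≡·𝟏 v))))

sum-comb : (s t r : ℚ) (A : Matrix n n) → (∀ x → sum (A x) ≡ 0ℚ) →
           ∀ x → sum (comb s t r A x) ≡ s + t * ι n
sum-comb {n} s t r A A0 x = begin
  sum (comb s t r A x)                             ≡⟨ sum-lin₃ s t r (basis x) 𝟏 (A x) ⟩
  s * sum (basis x) + t * sum {n} 𝟏 + r * sum (A x)
    ≡⟨ cong₂ _+_ (cong₂ (λ a b → s * a + t * b) (sum-basis x) (sum-𝟏 n)) (cong (r *_) (A0 x)) ⟩
  s * 1ℚ + t * ι n + r * 0ℚ
    ≡⟨ solve 3 (λ s t r → s :* con 1ℚ :+ t :+ r :* con 0ℚ := s :+ t) refl s (t * ι n) r ⟩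
  s + t * ι n                                      ∎

comb-sym : (s t r : ℚ) (A : Matrix n n) → Symmetric A → Symmetric (comb s t r A)
comb-sym s t r A A-sym x y = cong₂ (λ a b → s * a + t * 1ℚ + r * b) (basis-sym x y) (A-sym x y)

trace-comb : (s t r : ℚ) (A : Matrix n n) → trace (comb s t r A) ≡ s * ι n + t * ι n + r * trace A
trace-comb {n} s t r A = trans (sum-lin₃ s t r (λ x → basis x x) 𝟏 (λ x → A x x))
  (cong₂ (λ a b → s * a + t * b + r * trace A) (trans (sum-cong-≗ {n} (λ x → basis-yes {x = x} refl)) (sum-𝟏 n)) (sum-𝟏 n))

Λ-𝟏 : (R : Fin n → Fin n → Bool) → ∀ x → sum (Λ R x) ≡ 0ℚ
Λ-𝟏 R x = begin
  sum (Λ R x)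
    ≡⟨ sum-cong-≗ (λ y → solve 3 (λ b d a →
         b :* d :- a := d :* b :+ con (- 1ℚ) :* a) refl (basis x y) (deg R x) (⟦ R ⟧ x y)) ⟩
  sum (λ y → deg R x * basis x y + (- 1ℚ) * ⟦ R ⟧ x y)
    ≡⟨ sum-lin₂ (deg R x) (- 1ℚ) (basis x) (⟦ R ⟧ x) ⟩
  deg R x * sum (basis x) + (- 1ℚ) * deg R x
    ≡⟨ cong (λ z → deg R x * z + (- 1ℚ) * deg R x) (sum-basis x) ⟩
  deg R x * 1ℚ + (- 1ℚ) * deg R x
    ≡⟨ solve 1 (λ d → d :* con 1ℚ :+ con (- 1ℚ) :* d := con 0ℚ) refl (deg R x) ⟩
  0ℚ                                                   ∎

-- A matching seen from a single vertex: every vertex has at most one partner. This form applies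
-- both to `M` and to what is left of the path after an edge is removed.
record IsMatchingRelation (R : Fin n → Fin n → Bool) : Set where
  field
    R-sym      : ∀ x y → R x y ≡ R y x
    R-irrefl   : ∀ x → R x x ≡ false
    functional : ∀ {x y z} → T (R x y) → T (R x z) → y ≡ z

  private
    a : Matrix _ _
    a = ⟦ R ⟧
    d : Vector ℚ _
    d = deg R

  a-sym : Symmetric a
  a-sym x y = cong (if_then 1ℚ else 0ℚ) (R-sym x y)

  -- If `y` is the partner of `x`, the row of `x` is the unit vector at `y`; otherwise the common
  -- factor `a x y` vanishes.
  a-row : ∀ x y z → a x z * a x y ≡ basis y z * a x y
  a-row x y z with z Fin.≟ y
  a-row x y .y | yes refl with R x y
  ... | true  = refl
  ... | false = refl
  a-row x y z | no z≢y with R x z | R x y | functional {x} {z} {y}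
  ... | true  | true  | f = ⊥-elim (z≢y (f tt tt))
  ... | true  | false | _ = refl
  ... | false | true  | _ = refl
  ... | false | false | _ = refl

  -- Degrees are 0 or 1, and a vertex with a partner has degree 1. In matrix form this is `DA = A`;
  -- summing its rows gives `D² = D`.
  deg-absorb : ∀ x y → d x * a x y ≡ a x y
  deg-absorb x y = begin
    d x * a x y                  ≡⟨ *-distribʳ-sum (a x y) (a x) ⟩
    sum (λ z → a x z * a x y)    ≡⟨ sum-cong-≗ (a-row x y) ⟩
    basis y · (λ _ → a x y)      ≡⟨ basis-· y (λ _ → a x y) ⟩
    a x y                        ∎

  deg-idem : ∀ x → d x * d x ≡ d x
  deg-idem x = trans (*-distribˡ-sum (d x) (a x)) (sum-cong-≗ (deg-absorb x))

  deg≡1 : ∀ {x y} → T (R x y) → d x ≡ 1ℚ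
  deg≡1 {x} {y} t = begin
    d x          ≡⟨ sym (*-identityʳ (d x)) ⟩
    d x * 1ℚ     ≡⟨ cong (d x *_) (sym (⟦⟧-true R t)) ⟩
    d x * a x y  ≡⟨ deg-absorb x y ⟩
    a x y        ≡⟨ ⟦⟧-true R t ⟩
    1ℚ           ∎

  -- Distinct vertices have no common neighbour, since that neighbour would have two partners. In
  -- matrix form, `A² = D`.
  rows-orthogonal : ∀ x y → a x · a y ≡ basis x y * d y
  rows-orthogonal x y = begin
    a x · a y
      ≡⟨ sum-cong-≗ (λ z → trans (cong₂ _*_ (a-sym x z) (a-sym y z)) (a-row z y x)) ⟩
    sum (λ z → basis y x * a z y)   ≡⟨ sym (*-distribˡ-sum (basis y x) (λ z → a z y)) ⟩
    basis y x * sum (λ z → a z y)   ≡⟨ cong₂ _*_ (basis-sym y x) (sum-cong-≗ (λ z → a-sym z y)) ⟩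
    basis x y * d y                 ∎

  Λ-sym : Symmetric (Λ R)
  Λ-sym x y = cong₂ _-_ (trans (basis-*-cong d x y) (cong (_* d y) (basis-sym x y))) (a-sym x y)

  -- Expand `(D - A)²` with `D² = D`, `DA = AD = A` and `A² = D`. Rows may be paired with rows
  -- because `Λ` is symmetric.
  Λ-·-Λ : ∀ x y → Λ R x · Λ R y ≡ 2ℚ * Λ R x y
  Λ-·-Λ x y = begin
    Λ R x · Λ R y
      ≡⟨ sum-cong-≗ (λ j → solve 4 (λ b d a l →
           (b :* d :- a) :* l
           := d :* (b :* l) :+ con (- 1ℚ) :* (a :* l)) refl (basis x j) (d x) (a x j) (Λ R y j)) ⟩
    sum (λ j → d x * (basis x j * Λ R y j) + (- 1ℚ) * (a x j * Λ R y j))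
      ≡⟨ sum-lin₂ (d x) (- 1ℚ) (λ j → basis x j * Λ R y j) (λ j → a x j * Λ R y j) ⟩
    d x * (basis x · Λ R y) + (- 1ℚ) * (a x · Λ R y)
      ≡⟨ cong₂ (λ s t → d x * s + (- 1ℚ) * t) (trans (basis-· x (Λ R y)) (Λ-sym y x)) a·Λ ⟩
    d x * (basis x y * d x - a x y) + (- 1ℚ) * (a x y - basis x y * d x)
      ≡⟨ solve 3 (λ d b a →
           d :* (b :* d :- a) :+ con (- 1ℚ) :* (a :- b :* d)
           := b :* (d :* d) :- d :* a :+ (b :* d :- a)) refl (d x) (basis x y) (a x y) ⟩
    basis x y * (d x * d x) - d x * a x y + (basis x y * d x - a x y)
      ≡⟨ cong₂ (λ s t → basis x y * s - t + (basis x y * d x - a x y))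
           (deg-idem x) (deg-absorb x y) ⟩
    Λ R x y + Λ R x y
      ≡⟨ solve 1 (λ l → l :+ l := con 2ℚ :* l) refl (Λ R x y) ⟩
    2ℚ * Λ R x y ∎
    where
    a·Λ : a x · Λ R y ≡ a x y - basis x y * d x
    a·Λ = begin
      a x · Λ R y
        ≡⟨ sum-cong-≗ (λ j → solve 4 (λ b d a c →
             c :* (b :* d :- a)
             := d :* (b :* c) :+ con (- 1ℚ) :* (c :* a)) refl (basis y j) (d y) (a y j) (a x j)) ⟩
      sum (λ j → d y * (basis y j * a x j) + (- 1ℚ) * (a x j * a y j))
        ≡⟨ sum-lin₂ (d y) (- 1ℚ) (λ j → basis y j * a x j) (λ j → a x j * a y j) ⟩
      d y * (basis y · a x) + (- 1ℚ) * (a x · a y)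
        ≡⟨ cong₂ (λ s t → d y * s + (- 1ℚ) * t) (basis-· y (a x)) (rows-orthogonal x y) ⟩
      d y * a x y + (- 1ℚ) * (basis x y * d y)
        ≡⟨ cong₂ (λ s t → s + (- 1ℚ) * t)
             (trans (cong (d y *_) (a-sym x y)) (trans (deg-absorb y x) (a-sym y x))) (sym (basis-*-cong d x y)) ⟩
      a x y + (- 1ℚ) * (basis x y * d x)
        ≡⟨ solve 2 (λ a b → a :+ con (- 1ℚ) :* b := a :- b) refl (a x y) (basis x y * d x) ⟩
      a x y - basis x y * d x ∎

  trace-Λ : trace (Λ R) ≡ sum d
  trace-Λ = sum-cong-≗ (λ x → begin
    basis x x * d x - a x x
      ≡⟨ cong₂ (λ s t → s * d x - t)
           (basis-yes {x = x} refl) (cong (if_then 1ℚ else 0ℚ) (R-irrefl x)) ⟩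
    1ℚ * d x - 0ℚ            ≡⟨ solve 1 (λ d → con 1ℚ :* d :- con 0ℚ := d) refl (d x) ⟩
    d x                      ∎)

  -- (nI - J - Λ)⁺, from Λ² = 2Λ.
  pseudoinverse : {q r : ℚ} → q * ι n ≡ 1ℚ → r * (ι n - 2ℚ) ≡ 1ℚ →
    IsLaplacianInverse q (comb (ι n) (- 1ℚ) (- 1ℚ) (Λ R)) (comb q (- (q * q)) (q * r) (Λ R))
  pseudoinverse {q} {r} qn rn = record
    { L-sym = comb-sym (ι n) (- 1ℚ) (- 1ℚ) (Λ R) Λ-sym
    ; X-sym = comb-sym q (- (q * q)) (q * r) (Λ R) Λ-sym
    ; L𝟏≡0  = λ x → trans (sum-comb (ι n) (- 1ℚ) (- 1ℚ) (Λ R) (Λ-𝟏 R) x)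
                (solve 1 (λ n → n :+ con (- 1ℚ) :* n := con 0ℚ) refl (ι n))
    ; X𝟏≡0  = X𝟏≡0
    ; LX    = λ x y → begin
        (comb (ι n) (- 1ℚ) (- 1ℚ) (Λ R) ⊗ X) x y
          ≡⟨ comb-*ᵥ (ι n) (- 1ℚ) (- 1ℚ) (Λ R) (λ j → X j y) x ⟩
        ι n * X x y + (- 1ℚ) * sum (λ j → X j y) + (- 1ℚ) * (Λ R x · (λ j → X j y))
          ≡⟨ cong₂ (λ s t → ι n * X x y + (- 1ℚ) * s + (- 1ℚ) * t)
               (trans (sum-cong-≗ (λ j → X-sym j y)) (X𝟏≡0 y)) (Λ·X x y) ⟩
        ι n * (q * basis x y + (- (q * q)) * 1ℚ + q * r * Λ R x y) + (- 1ℚ) * 0ℚ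
          + (- 1ℚ) * (q * Λ R x y + q * r * (2ℚ * Λ R x y))
          -- The coefficient of `Λ` collects to `q (r (n - 2) - 1)`: the 2 of `Λ² = 2Λ` is what
          -- turns `n` into `n - 2`.
          ≡⟨ solve 5 (λ n q r b l →
               n :* (q :* b :+ (:- (q :* q)) :* con 1ℚ :+ q :* r :* l) :+ con (- 1ℚ) :* con 0ℚ
                 :+ con (- 1ℚ) :* (q :* l :+ q :* r :* (con 2ℚ :* l))
               := q :* n :* b :- q :* (q :* n) :+ q :* (r :* (n :- con 2ℚ) :- con 1ℚ) :* l) refl
               (ι n) q r (basis x y) (Λ R x y) ⟩
        q * ι n * basis x y - q * (q * ι n) + q * (r * (ι n - 2ℚ) - 1ℚ) * Λ R x y
          ≡⟨ cong₂ (λ s t → s * basis x y - q * s + q * (t - 1ℚ) * Λ R x y) qn rn ⟩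
        1ℚ * basis x y - q * 1ℚ + q * (1ℚ - 1ℚ) * Λ R x y
          ≡⟨ solve 3 (λ q b l →
               con 1ℚ :* b :- q :* con 1ℚ :+ q :* (con 1ℚ :- con 1ℚ) :* l
               := b :- q) refl q (basis x y) (Λ R x y) ⟩
        basis x y - q ∎
    }
    where
    X : Matrix n n
    X = comb q (- (q * q)) (q * r) (Λ R)
    X-sym : Symmetric X
    X-sym = comb-sym q (- (q * q)) (q * r) (Λ R) Λ-sym
    X𝟏≡0 : ∀ x → sum (X x) ≡ 0ℚ
    X𝟏≡0 x = begin
      sum (X x)                ≡⟨ sum-comb q (- (q * q)) (q * r) (Λ R) (Λ-𝟏 R) x ⟩
      q + (- (q * q)) * ι n
        ≡⟨ solve 2 (λ q n → q :+ (:- (q :* q)) :* n := q :* (con 1ℚ :- q :* n)) refl q (ι n) ⟩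
      q * (1ℚ - q * ι n)       ≡⟨ cong (λ z → q * (1ℚ - z)) qn ⟩
      q * (1ℚ - 1ℚ)            ≡⟨ *-zeroʳ q ⟩
      0ℚ                       ∎
    Λ·X : ∀ x y → Λ R x · (λ j → X j y) ≡ q * Λ R x y + q * r * (2ℚ * Λ R x y)
    Λ·X x y = begin
      Λ R x · (λ j → X j y)   ≡⟨ ·-congʳ (Λ R x) (λ j → X-sym j y) ⟩
      Λ R x · X y             ≡⟨ ·-lin₃ q (- (q * q)) (q * r) (Λ R x) (basis y) 𝟏 (Λ R y) ⟩
      q * (Λ R x · basis y) + (- (q * q)) * (Λ R x · 𝟏) + q * r * (Λ R x · Λ R y)
        ≡⟨ cong₂ (λ s t → q * s + (- (q * q)) * t + q * r * (Λ R x · Λ R y))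
             (trans (·-comm (Λ R x) (basis y)) (basis-· y (Λ R x))) (trans (sym (sum≡·𝟏 (Λ R x))) (Λ-𝟏 R x)) ⟩
      q * Λ R x y + (- (q * q)) * 0ℚ + q * r * (Λ R x · Λ R y)
        ≡⟨ cong₂ (λ s t → q * Λ R x y + s + q * r * t) (*-zeroʳ (- (q * q))) (Λ-·-Λ x y) ⟩
      q * Λ R x y + 0ℚ + q * r * (2ℚ * Λ R x y)
        ≡⟨ cong (_+ q * r * (2ℚ * Λ R x y)) (+-identityʳ (q * Λ R x y)) ⟩
      q * Λ R x y + q * r * (2ℚ * Λ R x y) ∎

module _ (F : EdgeSet (K n)) where

  has-irrefl : ∀ x → has F x x ≡ false
  has-irrefl x with has F x x | has⇒adj F x x
  ... | false | _ = refl
  ... | true  | f with () ← subst T (adj-irrefl (K n) x) (f tt)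

  private
    a : Matrix n n
    a = ⟦ has F ⟧
    A : Matrix n n
    A = adjacencyMatrix (K n ─ F)

    A≡ : ∀ x y → A x y ≡ lin₃ (- 1ℚ) 1ℚ (- 1ℚ) (basis x) 𝟏 (a x) y
    A≡ x y with x Fin.≟ y
    A≡ x .x | yes refl rewrite has-irrefl x | basis-yes {x = x} refl = refl
    A≡ x y  | no x≢y rewrite basis-no {x = x} (x≢y ∘ sym) with has F x y
    ... | true  = refl
    ... | false = refl

    degree≡ : ∀ x → degree (K n ─ F) x ≡ ι n - 1ℚ - deg (has F) x
    degree≡ x = begin
      sum (A x) ≡⟨ sum-cong-≗ (A≡ x) ⟩
      sum (lin₃ (- 1ℚ) 1ℚ (- 1ℚ) (basis x) 𝟏 (a x)) ≡⟨ sum-lin₃ (- 1ℚ) 1ℚ (- 1ℚ) (basis x) 𝟏 (a x) ⟩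
      (- 1ℚ) * sum (basis x) + 1ℚ * sum {n} 𝟏 + (- 1ℚ) * deg (has F) x
        ≡⟨ cong₂ (λ s t → (- 1ℚ) * s + 1ℚ * t + (- 1ℚ) * deg (has F) x) (sum-basis x) (sum-𝟏 n) ⟩
      (- 1ℚ) * 1ℚ + 1ℚ * ι n + (- 1ℚ) * deg (has F) x
        ≡⟨ solve 2 (λ n d →
             con (- 1ℚ) :* con 1ℚ :+ con 1ℚ :* n :+ con (- 1ℚ) :* d
             := n :- con 1ℚ :- d) refl (ι n) (deg (has F) x) ⟩
      ι n - 1ℚ - deg (has F) x ∎

    degreeMatrix≡ : ∀ x y → degreeMatrix (K n ─ F) x y ≡ basis x y * degree (K n ─ F) x
    degreeMatrix≡ x y with x Fin.≟ y
    ... | yes refl = sym (trans (cong (_* degree (K n ─ F) x) (basis-yes {x = x} refl))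
                       (*-identityˡ (degree (K n ─ F) x)))
    ... | no  x≢y  = sym (trans (cong (_* degree (K n ─ F) x) (basis-no {x = x} (x≢y ∘ sym)))
                       (*-zeroˡ (degree (K n ─ F) x)))

  laplacian-─ : ∀ x y → laplacian (K n ─ F) x y ≡ comb (ι n) (- 1ℚ) (- 1ℚ) (Λ (has F)) x y
  laplacian-─ x y = begin
    degreeMatrix (K n ─ F) x y - A x y
      ≡⟨ cong₂ _-_ (trans (degreeMatrix≡ x y) (cong (basis x y *_) (degree≡ x))) (A≡ x y) ⟩
    basis x y * (ι n - 1ℚ - deg (has F) x) - lin₃ (- 1ℚ) 1ℚ (- 1ℚ) (basis x) 𝟏 (a x) y
      ≡⟨ solve 4 (λ b n d a →
           b :* (n :- con 1ℚ :- d) :- (con (- 1ℚ) :* b :+ con 1ℚ :* con 1ℚ :+ con (- 1ℚ) :* a)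
           := n :* b :+ con (- 1ℚ) :* con 1ℚ :+ con (- 1ℚ) :* (b :* d :- a)) refl
           (basis x y) (ι n) (deg (has F) x) (a x y) ⟩
    comb (ι n) (- 1ℚ) (- 1ℚ) (Λ (has F)) x y ∎

-- Deleting a matching and a path

trace-update : (s : ℚ) (X : Matrix n n) (w : Vector ℚ n) →
               trace (λ x y → X x y + s * (w x * w y)) ≡ trace X + s * (w · w)
trace-update s X w = begin
  sum (λ x → X x x + s * (w x * w x))
    ≡⟨ sum-cong-≗ (λ x → cong (_+ s * (w x * w x)) (sym (*-identityˡ (X x x)))) ⟩
  sum (λ x → 1ℚ * X x x + s * (w x * w x))  ≡⟨ sum-lin₂ 1ℚ s (λ x → X x x) (λ x → w x * w x) ⟩
  1ℚ * trace X + s * (w · w)                ≡⟨ cong (_+ s * (w · w)) (*-identityˡ (trace X)) ⟩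
  trace X + s * (w · w)                     ∎

-- Where `d` is nonzero, exactly one `i` satisfies `ψ i ≡ x`, so the factor
-- `1 = sum (λ i → basis (ψ i) x)` can be inserted and the two sums exchanged.
sum-reindex : (ψ : Fin m → Fin n) → (∀ {i j} → ψ i ≡ ψ j → i ≡ j) → (d : Vector ℚ n) →
              (∀ x → d x ≡ 0ℚ ⊎ ∃[ i ] ψ i ≡ x) → sum d ≡ sum (d ∘ ψ)
sum-reindex {m} {n} ψ ψ-inj d supp = begin
  sum d                                                  ≡⟨ sum-cong-≗ insert ⟩
  sum (λ x → sum (λ i → basis (ψ i) x * d x))
    ≡⟨ ∑-comm {n} {m} (λ x i → basis (ψ i) x * d x) ⟩
  sum (λ i → basis (ψ i) · d)                            ≡⟨ sum-cong-≗ (λ i → basis-· (ψ i) d) ⟩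
  sum (d ∘ ψ)                                            ∎
  where
  basis-ψ : ∀ i j → basis (ψ i) (ψ j) ≡ basis j i
  basis-ψ i j with i Fin.≟ j
  ... | yes refl = basis-yes {x = ψ i} refl
  ... | no  i≢j  = basis-no (i≢j ∘ sym ∘ ψ-inj)
  insert : ∀ x → d x ≡ sum (λ i → basis (ψ i) x * d x)
  insert x with supp x
  ... | inj₁ d0 = trans d0 (sym (sum-0 (λ i → trans (cong (basis (ψ i) x *_) d0) (*-zeroʳ (basis (ψ i) x)))))
  ... | inj₂ (j , refl) = begin
    d (ψ j)                                   ≡⟨ sym (*-identityˡ (d (ψ j))) ⟩
    1ℚ * d (ψ j)
      ≡⟨ cong (_* d (ψ j)) (sym (trans (sum-cong-≗ (λ i → basis-ψ i j)) (sum-basis j))) ⟩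
    sum (λ i → basis (ψ i) (ψ j)) * d (ψ j)
      ≡⟨ *-distribʳ-sum (d (ψ j)) (λ i → basis (ψ i) (ψ j)) ⟩
    sum (λ i → basis (ψ i) (ψ j) * d (ψ j))   ∎

-- Removes all edges at `c`. For the end `c` of the path this is just the edge `bc`, and no mention
-- of `b` is needed.
isolate : Fin n → (Fin n → Fin n → Bool) → Fin n → Fin n → Bool
isolate c R x y = R x y ∧ not (does (x Fin.≟ c) ∨ does (y Fin.≟ c))

isolate⁺ : (c : Fin n) (R : Fin n → Fin n → Bool) {x y : Fin n} → x ≢ c → y ≢ c → T (R x y) → T (isolate c R x y)
isolate⁺ c R {x} {y} x≢c y≢c t
  rewrite dec-false (x Fin.≟ c) x≢c | dec-false (y Fin.≟ c) y≢c with R x y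
... | true = tt

isolate⁻ : (c : Fin n) (R : Fin n → Fin n → Bool) {x y : Fin n} → T (isolate c R x y) → T (R x y) × x ≢ c × y ≢ c
isolate⁻ c R {x} {y} t with R x y | x Fin.≟ c | y Fin.≟ c
... | true | no x≢c | no y≢c = tt , x≢c , y≢c

-- The component containing c is the path a - b - c; all other components
-- are single vertices or edges.
record IsMatchingPlusPath (R : Fin n → Fin n → Bool) (a b c : Fin n) : Set where
  field
    R-sym      : ∀ x y → R x y ≡ R y x
    R-irrefl   : ∀ x → R x x ≡ false
    Rba        : T (R b a)
    Rbc        : T (R b c)
    a≢c        : a ≢ c
    functional : ∀ {x y z} → x ≢ b → T (R x y) → T (R x z) → y ≡ z
    b-nbr      : ∀ {y} → T (R b y) → y ≡ a ⊎ y ≡ c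

  a≢b : a ≢ b
  a≢b refl = subst T (R-irrefl a) Rba

  b≢c : b ≢ c
  b≢c refl = subst T (R-irrefl b) Rbc

  c-nbr : ∀ {y} → T (R c y) → y ≡ b
  c-nbr t = functional (b≢c ∘ sym) t (subst T (R-sym b c) Rbc)

  R′ : Fin n → Fin n → Bool
  R′ = isolate c R

  -- Only `b` can have two neighbours, and one of them, `c`, has been isolated.
  matching : IsMatchingRelation R′
  matching = record
    { R-sym      = λ x y → cong₂ (λ s t → s ∧ not t) (R-sym x y) (∨-comm (does (x Fin.≟ c)) (does (y Fin.≟ c)))
    ; R-irrefl   = λ x → cong (_∧ not (does (x Fin.≟ c) ∨ does (x Fin.≟ c))) (R-irrefl x)
    ; functional = fun
    }
    where
    fun : ∀ {x y z} → T (R′ x y) → T (R′ x z) → y ≡ z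
    fun {x} {y} {z} t u with isolate⁻ c R {x} {y} t | isolate⁻ c R {x} {z} u | x Fin.≟ b
    ... | Rxy , _        | Rxz , _        | no x≢b  = functional x≢b Rxy Rxz
    ... | Rby , _ , y≢c | Rbz , _ , z≢c | yes refl with b-nbr Rby | b-nbr Rbz
    ...   | inj₁ y≡a | inj₁ z≡a = trans y≡a (sym z≡a)
    ...   | inj₂ y≡c | _        = ⊥-elim (y≢c y≡c)
    ...   | _        | inj₂ z≡c = ⊥-elim (z≢c z≡c)

  module M = IsMatchingRelation matching

  -- Signed incidence vectors of the two path edges. The outer product of `v` with itself is the
  -- Laplacian of the single edge `bc`.
  v u : Vector ℚ n
  v = basis b -ᵥ basis c
  u = basis b -ᵥ basis a

  R′-c : ∀ y → ⟦ R′ ⟧ c y ≡ 0ℚ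
  R′-c y = ⟦⟧-false R′ {c} {y} (λ t → proj₁ (proj₂ (isolate⁻ c R {c} {y} t)) refl)

  R′ba : T (R′ b a)
  R′ba = isolate⁺ c R b≢c a≢c Rba

  R′-b : ∀ y → ⟦ R′ ⟧ b y ≡ basis a y
  R′-b y with y Fin.≟ a
  ... | yes refl = ⟦⟧-true R′ R′ba
  ... | no  y≢a  = ⟦⟧-false R′ (λ t → y≢a (M.functional {b} {y} {a} t R′ba))

  deg-c : deg R′ c ≡ 0ℚ
  deg-c = sum-0 R′-c

  -- Away from `c` nothing is removed, and `b` is the only neighbour of `c`; the matrices differ
  -- just at the two positions of `bc`.
  ⟦R⟧≡ : ∀ x y → ⟦ R ⟧ x y ≡ ⟦ R′ ⟧ x y + (basis b x * basis c y + basis c x * basis b y)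
  ⟦R⟧≡ x y with x Fin.≟ c | y Fin.≟ c
  ... | yes refl | yes refl
    rewrite R-irrefl c | basis-no {x = b} {c} (b≢c ∘ sym) = refl
  ... | yes refl | no  y≢c rewrite basis-no {x = b} {c} (b≢c ∘ sym) with y Fin.≟ b | R c y in Rcy
  ...   | yes refl | true  = refl
  ...   | yes refl | false = ⊥-elim (subst T (trans (R-sym b c) Rcy) Rbc)
  ...   | no  y≢b  | true  = ⊥-elim (y≢b (c-nbr (subst T (sym Rcy) tt)))
  ...   | no  y≢b  | false = refl
  ⟦R⟧≡ x y | no x≢c | yes refl rewrite basis-no {x = b} {c} (b≢c ∘ sym) with x Fin.≟ b | R x c in Rxc
  ...   | yes refl | true  = refl
  ...   | yes refl | false = ⊥-elim (subst T Rxc Rbc)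
  ...   | no  x≢b  | true  = ⊥-elim (x≢b (c-nbr (subst T (trans (sym Rxc) (R-sym x c)) tt)))
  ...   | no  x≢b  | false = refl
  ⟦R⟧≡ x y | no x≢c | no y≢c with R x y
  ...   | true  = sym (cong (λ z → 1ℚ + z) (cong₂ _+_ (*-zeroʳ (basis b x)) (*-zeroˡ (basis b y))))
  ...   | false = sym (cong (λ z → 0ℚ + z) (cong₂ _+_ (*-zeroʳ (basis b x)) (*-zeroˡ (basis b y))))

  deg≡ : ∀ x → deg R x ≡ deg R′ x + (basis b x + basis c x)
  deg≡ x = begin
    deg R x
      ≡⟨ sum-cong-≗ (λ y → trans (⟦R⟧≡ x y) (solve 5 (λ a p q s t →
           a :+ (p :* q :+ s :* t) := con 1ℚ :* a :+ p :* q :+ s :* t) refl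
                 (⟦ R′ ⟧ x y) (basis b x) (basis c y) (basis c x) (basis b y))) ⟩
    sum (lin₃ 1ℚ (basis b x) (basis c x) (⟦ R′ ⟧ x) (basis c) (basis b))
      ≡⟨ sum-lin₃ 1ℚ (basis b x) (basis c x) (⟦ R′ ⟧ x) (basis c) (basis b) ⟩
    1ℚ * deg R′ x + basis b x * sum (basis c) + basis c x * sum (basis b)
      ≡⟨ cong₂ (λ s t → 1ℚ * deg R′ x + basis b x * s + basis c x * t) (sum-basis c) (sum-basis b) ⟩
    1ℚ * deg R′ x + basis b x * 1ℚ + basis c x * 1ℚ
      ≡⟨ solve 3 (λ d p q →
           con 1ℚ :* d :+ p :* con 1ℚ :+ q :* con 1ℚ
           := d :+ (p :+ q)) refl (deg R′ x) (basis b x) (basis c x) ⟩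
    deg R′ x + (basis b x + basis c x) ∎

  Λ-split : ∀ x y → Λ R x y ≡ Λ R′ x y + v x * v y
  Λ-split x y = begin
    basis x y * deg R x - ⟦ R ⟧ x y ≡⟨ cong₂ (λ s t → basis x y * s - t) (deg≡ x) (⟦R⟧≡ x y) ⟩
    basis x y * (deg R′ x + (basis b x + basis c x)) - (⟦ R′ ⟧ x y + (basis b x * basis c y + basis c x * basis b y))
      ≡⟨ solve 7 (λ e d p q a p′ q′ → e :* (d :+ (p :+ q)) :- (a :+ (p :* q′ :+ q :* p′))
           := (e :* d :- a) :+ (p :* e :+ q :* e :- p :* q′ :- q :* p′)) refl
           (basis x y) (deg R′ x) (basis b x) (basis c x) (⟦ R′ ⟧ x y) (basis b y) (basis c y) ⟩
    Λ R′ x y + (basis b x * basis x y + basis c x * basis x y - basis b x * basis c y - basis c x * basis b y)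
      -- The degree corrections at `b` and `c` become the diagonal entries of the outer product of
      -- `v` with itself.
      ≡⟨ cong₂ (λ s t → Λ R′ x y + (s + t - basis b x * basis c y - basis c x * basis b y))
           (diagonal b) (diagonal c) ⟩
    Λ R′ x y + (basis b x * basis b y + basis c x * basis c y - basis b x * basis c y - basis c x * basis b y)
      ≡⟨ solve 5 (λ l p q p′ q′ →
           l :+ (p :* p′ :+ q :* q′ :- p :* q′ :- q :* p′) := l :+ (p :- q) :* (p′ :- q′)) refl
           (Λ R′ x y) (basis b x) (basis c x) (basis b y) (basis c y) ⟩
    Λ R′ x y + v x * v y ∎
    where
    diagonal : ∀ z → basis z x * basis x y ≡ basis z x * basis z y
    diagonal z = sym (basis-*-cong (λ w → basis w y) z x)

  -- After the removal `c` is isolated, so `Λ` kills its basis vector, and `a` is the only neighbour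
  -- of `b`.
  Λv≡u : ∀ x → (Λ R′ *ᵥ v) x ≡ u x
  Λv≡u x = begin
    Λ R′ x · v ≡⟨ ·-comm (Λ R′ x) v ⟩
    v · Λ R′ x ≡⟨ difference-· b c (Λ R′ x) ⟩
    Λ R′ x b - Λ R′ x c ≡⟨ cong₂ _-_ (M.Λ-sym x b) (M.Λ-sym x c) ⟩
    (basis b x * deg R′ b - ⟦ R′ ⟧ b x) - (basis c x * deg R′ c - ⟦ R′ ⟧ c x)
      ≡⟨ cong₂ _-_ (cong₂ (λ s t → basis b x * s - t) (M.deg≡1 R′ba) (R′-b x))
               (cong₂ (λ s t → basis c x * s - t) deg-c (R′-c x)) ⟩
    (basis b x * 1ℚ - basis a x) - (basis c x * 0ℚ - 0ℚ)
      ≡⟨ solve 3 (λ p q s →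
           (p :* con 1ℚ :- q) :- (s :* con 0ℚ :- con 0ℚ)
           := p :- q) refl (basis b x) (basis a x) (basis c x) ⟩
    u x ∎

  v0 : sum v ≡ 0ℚ
  v0 = trans (sum≡·𝟏 v) (difference-· b c 𝟏)

  -- This and the next two lemmas form the Gram matrix of `v` and `u`: the two edges share only `b`,
  -- and both vectors are oriented with `b` positive.
  v·v : v · v ≡ 2ℚ
  v·v = trans (difference-· b c v)
    (cong₂ _-_ (cong₂ _-_ (basis-yes {x = b} refl) (basis-no b≢c))
           (cong₂ _-_ (basis-no {x = b} (b≢c ∘ sym)) (basis-yes {x = c} refl)))

  v·u : v · u ≡ 1ℚ
  v·u = trans (difference-· b c u)
    (cong₂ _-_ (cong₂ _-_ (basis-yes {x = b} refl) (basis-no (a≢b ∘ sym)))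
           (cong₂ _-_ (basis-no {x = b} (b≢c ∘ sym)) (basis-no (a≢c ∘ sym))))

  u·u : u · u ≡ 2ℚ
  u·u = trans (difference-· b a u)
    (cong₂ _-_ (cong₂ _-_ (basis-yes {x = b} refl) (basis-no (a≢b ∘ sym)))
           (cong₂ _-_ (basis-no a≢b) (basis-yes {x = a} refl)))

-- Transporting the structure of the model graph along the isomorphism

PathAndEdges : ℕ → Set
PathAndEdges k = Fin 3 ⊎ (Fin k × Fin 2)

pathAndEdges : (k : ℕ) → SimpleGraph (PathAndEdges k)
pathAndEdges k = P 3 ∪ k copies K 2

module _ {k : ℕ} where

  path-centre-nbr : {w : PathAndEdges k} → T (adj (pathAndEdges k) (inj₁ 1F) w) → w ≡ inj₁ 0F ⊎ w ≡ inj₁ 2F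
  path-centre-nbr {inj₁ 0F} _ = inj₁ refl
  path-centre-nbr {inj₁ 2F} _ = inj₂ refl

  -- An end of the path sees only the centre, and a vertex of a copy of `K 2` sees only the other
  -- vertex of that copy.
  nbr-unique : {w x y : PathAndEdges k} → w ≢ inj₁ 1F → T (adj (pathAndEdges k) w x) →
               T (adj (pathAndEdges k) w y) → x ≡ y
  nbr-unique {inj₁ 0F} {inj₁ 1F} {inj₁ 1F} _ _ _ = refl
  nbr-unique {inj₁ 2F} {inj₁ 1F} {inj₁ 1F} _ _ _ = refl
  nbr-unique {inj₁ 2F} {inj₁ 2F} _ ()
  nbr-unique {inj₁ 2F} {inj₁ 1F} {inj₁ 2F} _ _ ()
  nbr-unique {inj₁ 1F} w≢ _ _ = ⊥-elim (w≢ refl)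
  nbr-unique {inj₂ (h , s)} {inj₂ (i , t)} {inj₂ (j , u)} _ tx ty with h Fin.≟ i | h Fin.≟ j
  nbr-unique {inj₂ (h , 0F)} {inj₂ (h , 1F)} {inj₂ (h , 1F)} _ _ _ | yes refl | yes refl = refl
  nbr-unique {inj₂ (h , 1F)} {inj₂ (h , 0F)} {inj₂ (h , 0F)} _ _ _ | yes refl | yes refl = refl
  nbr-unique {inj₂ (h , 1F)} {inj₂ (h , 1F)} _ () _ | yes refl | yes refl
  nbr-unique {inj₂ (h , 1F)} {inj₂ (h , 0F)} {inj₂ (h , 1F)} _ _ () | yes refl | yes refl

  edge-nbr : (i : Fin k) (s : Fin 2) → ∃[ t ] T (adj (pathAndEdges k) (inj₂ (i , s)) (inj₂ (i , t)))
  edge-nbr i 0F = 1F , subst (λ b → T (b ∧ true)) (sym (dec-true (i Fin.≟ i) refl)) tt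
  edge-nbr i 1F = 0F , subst (λ b → T (b ∧ true)) (sym (dec-true (i Fin.≟ i) refl)) tt

  -- The path occupies the first three indices, so a sum over this enumeration unfolds by
  -- computation to the terms of `a`, `b`, `c` and a remainder.
  enumeration : Fin (3 ℕ.+ k ℕ.* 2) ↔ PathAndEdges k
  enumeration = (↔-id (Fin 3) ⊎-↔ Fin.*↔×) ↔-∘ Fin.+↔⊎

module _ {k : ℕ} (F : EdgeSet (K n)) (iso : deletionGraph F ≅ pathAndEdges k) where

  private
    open module B = Inverse (_≅_.bijection iso) using (to; from)
    R : Fin n → Fin n → Bool
    R = has F

    φ : PathAndEdges k → Fin n
    φ = value ∘ from

    φ-adj : ∀ w x → R (φ w) (φ x) ≡ adj (pathAndEdges k) w x
    φ-adj w x = trans (_≅_.preserves iso (from w) (from x))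
                  (cong₂ (adj (pathAndEdges k)) (B.strictlyInverseˡ w) (B.strictlyInverseˡ x))

    -- The witness of being covered is irrelevant, so a covered vertex is determined by its `value`.
    φ-injective : ∀ {w x} → φ w ≡ φ x → w ≡ x
    φ-injective {w} {x} eq = begin
      w            ≡⟨ sym (B.strictlyInverseˡ w) ⟩
      to (from w)  ≡⟨ cong to (value-injective eq) ⟩
      to (from x)  ≡⟨ B.strictlyInverseˡ x ⟩
      x            ∎

    φ-covers : ∀ {x y} → T (R x y) → ∃[ w ] φ w ≡ x
    φ-covers {x} {y} t = to x′ , cong value (B.strictlyInverseʳ x′)
      where
      x′ : Covered F
      x′ = x , Irrelevant.[ y , t ]

    φ-edge : ∀ {w x} → T (adj (pathAndEdges k) w x) → T (R (φ w) (φ x))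
    φ-edge {w} {x} = subst T (sym (φ-adj w x))

    φ-edge⁻ : ∀ {w x} → T (R (φ w) (φ x)) → T (adj (pathAndEdges k) w x)
    φ-edge⁻ {w} {x} = subst T (φ-adj w x)

    -- Both endpoints of an edge are covered, so no edge leaves the image of `φ` and questions about
    -- neighbours can be settled in the model graph.
    φ-nbr : ∀ {w y} → T (R (φ w) y) → ∃[ x ] φ x ≡ y × T (adj (pathAndEdges k) w x)
    φ-nbr {w} {y} t with φ-covers (subst T (has-sym F (φ w) y) t)
    ... | x , refl = x , refl , φ-edge⁻ t

    a b c : Fin n
    a = φ (inj₁ 0F)
    b = φ (inj₁ 1F)
    c = φ (inj₁ 2F)

  matchingPlusPath : IsMatchingPlusPath R a b c
  matchingPlusPath = record
    { R-sym      = has-sym F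
    ; R-irrefl   = has-irrefl F
    ; Rba        = φ-edge {inj₁ 1F} {inj₁ 0F} tt
    ; Rbc        = φ-edge {inj₁ 1F} {inj₁ 2F} tt
    ; a≢c        = λ eq → case φ-injective eq of λ ()
    ; functional = functional
    ; b-nbr      = b-nbr
    }
    where
    functional : ∀ {x y z} → x ≢ b → T (R x y) → T (R x z) → y ≡ z
    functional x≢b s t with φ-covers s
    ... | w , refl with φ-nbr s | φ-nbr t
    ...   | x , refl , wx | y , refl , wy = cong φ (nbr-unique {w = w} {x} {y} (λ w≡ → x≢b (cong φ w≡)) wx wy)
    b-nbr : ∀ {y} → T (R b y) → y ≡ a ⊎ y ≡ c
    b-nbr t with φ-nbr t
    ... | w , refl , bx with path-centre-nbr {w = w} bx
    ...   | inj₁ refl = inj₁ refl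
    ...   | inj₂ refl = inj₂ refl

  open IsMatchingPlusPath matchingPlusPath

  -- The remaining matching consists of `ab` and the `k` single edges. Its degrees are 1 at `a`, `b`
  -- and the `2k` vertices of the copies of `K 2`, and 0 at `c` and at all uncovered vertices.
  sum-deg : sum (deg R′) ≡ 2ℚ * ι (suc k)
  sum-deg = begin
    sum (deg R′)                        ≡⟨ sum-reindex ψ ψ-injective (deg R′) support ⟩
    sum (deg R′ ∘ ψ)                    ≡⟨⟩
    deg R′ a + (deg R′ b + (deg R′ c + sum (λ j → deg R′ (ψ (suc (suc (suc j)))))))
      ≡⟨ cong₂ _+_ deg-a (cong₂ _+_ deg-b (cong₂ _+_ deg-c (trans (sum-cong-≗ deg-rest) (sum-𝟏 (k ℕ.* 2))))) ⟩
    1ℚ + (1ℚ + (0ℚ + ι (k ℕ.* 2)))      ≡⟨ cong (λ z → 1ℚ + (1ℚ + (0ℚ + z))) (ι-* k 2) ⟩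
    1ℚ + (1ℚ + (0ℚ + ι k * 2ℚ))
      ≡⟨ solve 1 (λ k →
           con 1ℚ :+ (con 1ℚ :+ (con 0ℚ :+ k :* con 2ℚ))
           := con 2ℚ :* (con 1ℚ :+ k)) refl (ι k) ⟩
    2ℚ * (1ℚ + ι k)                     ≡⟨ cong (2ℚ *_) (sym (ι-+ 1 k)) ⟩
    2ℚ * ι (suc k)                      ∎
    where
    module E = Inverse (enumeration {k})
    ψ : Fin (3 ℕ.+ k ℕ.* 2) → Fin n
    ψ = φ ∘ E.to
    ψ-injective : ∀ {i j} → ψ i ≡ ψ j → i ≡ j
    ψ-injective {i} {j} eq = begin
      i                ≡⟨ sym (E.strictlyInverseʳ i) ⟩
      E.from (E.to i)  ≡⟨ cong E.from (φ-injective eq) ⟩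
      E.from (E.to j)  ≡⟨ E.strictlyInverseʳ j ⟩
      j                ∎
    support : ∀ x → deg R′ x ≡ 0ℚ ⊎ ∃[ i ] ψ i ≡ x
    support x with Fin.any? (λ y → T? (R′ x y))
    ... | no  none    = inj₁ (sum-0 (λ y → ⟦⟧-false R′ (λ t → none (y , t))))
    ... | yes (y , t) with φ-covers (proj₁ (isolate⁻ c R {x} {y} t))
    ...   | w , refl = inj₂ (E.from w , cong φ (E.strictlyInverseˡ w))
    deg-b : deg R′ b ≡ 1ℚ
    deg-b = M.deg≡1 R′ba
    deg-a : deg R′ a ≡ 1ℚ
    deg-a = M.deg≡1 (subst T (IsMatchingRelation.R-sym matching b a) R′ba)
    deg-edge : ∀ e → deg R′ (φ (inj₂ e)) ≡ 1ℚ
    deg-edge (i , s) with edge-nbr i s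
    ... | t , st = M.deg≡1 (isolate⁺ c R {φ (inj₂ (i , s))} {φ (inj₂ (i , t))} (not-c s) (not-c t) (φ-edge st))
      where
      not-c : ∀ s → φ (inj₂ (i , s)) ≢ c
      not-c s eq = case φ-injective eq of λ ()
    deg-rest : ∀ j → deg R′ (ψ (suc (suc (suc j)))) ≡ 1ℚ
    deg-rest j = deg-edge (Inverse.to Fin.*↔× j)

-- Closed forms of the two Kirchhoff indices

module _ {q r : ℚ} (qn : q * ι n ≡ 1ℚ) (rn : r * (ι n - 2ℚ) ≡ 1ℚ) where

  Kf-matching : (M : EdgeSet (K n)) → IsMatchingRelation (has M) →
    Kf (K n ─ M) ≡ ι n * (q * ι n + (- (q * q)) * ι n + q * r * sum (deg (has M)))
  Kf-matching M matching = begin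
    Kf (K n ─ M)
      ≡⟨ Kf≡n*trace (K n ─ M) (IsLaplacianInverse-congˡ (λ x y → sym (laplacian-─ M x y)) (pseudoinverse {q} {r} qn rn)) ⟩
    ι n * trace (comb q (- (q * q)) (q * r) (Λ (has M)))
      ≡⟨ cong (ι n *_) (trace-comb q (- (q * q)) (q * r) (Λ (has M))) ⟩
    ι n * (q * ι n + (- (q * q)) * ι n + q * r * trace (Λ (has M)))
      ≡⟨ cong (λ z → ι n * (q * ι n + (- (q * q)) * ι n + q * r * z)) trace-Λ ⟩
    ι n * (q * ι n + (- (q * q)) * ι n + q * r * sum (deg (has M))) ∎
    where open IsMatchingRelation matching

  -- `s` is the reciprocal of the Sherman-Morrison denominator, where `v · (X *ᵥ v) = q (2 + r)`.
  -- The update adds `s` times the squared norm of `X *ᵥ v` to the trace; that norm is the last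
  -- factor.
  Kf-matchingPlusPath : {s : ℚ} → s * (1ℚ - q * (2ℚ + r)) ≡ 1ℚ → {a b c : Fin n}
    (F : EdgeSet (K n)) (mpp : IsMatchingPlusPath (has F) a b c) →
    Kf (K n ─ F) ≡ ι n * (q * ι n + (- (q * q)) * ι n + q * r * sum (deg (IsMatchingPlusPath.R′ mpp))
                          + s * (q * q * (2ℚ + 2ℚ * r + 2ℚ * (r * r))))
  Kf-matchingPlusPath {s} hs {a} {b} {c} F mpp = begin
    Kf (K n ─ F)
      ≡⟨ Kf≡n*trace (K n ─ F) (IsLaplacianInverse-congˡ L≡
           (rankOneUpdate {s = s} (M.pseudoinverse {q} {r} qn rn) v v0 (trans (cong (λ z → s * (1ℚ - z)) v·w) hs))) ⟩
    ι n * trace (λ x y → X x y + s * (w x * w y))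
      ≡⟨ cong (ι n *_) (trace-update s X w) ⟩
    ι n * (trace X + s * (w · w))
      ≡⟨ cong₂ (λ y z → ι n * (y + s * z))
           (trans (trace-comb q (- (q * q)) (q * r) (Λ R′))
                  (cong (λ z → q * ι n + (- (q * q)) * ι n + q * r * z) M.trace-Λ)) w·w ⟩
    ι n * (q * ι n + (- (q * q)) * ι n + q * r * sum (deg R′) + s * (q * q * (2ℚ + 2ℚ * r + 2ℚ * (r * r)))) ∎
    where
    open IsMatchingPlusPath mpp
    X : Matrix n n
    X = comb q (- (q * q)) (q * r) (Λ R′)
    w : Vector ℚ n
    w = X *ᵥ v
    -- `v` is orthogonal to `𝟏`, so the `J` part of `X` drops out and `w` lies in the span of `v`
    -- and `u`; all products then follow from their Gram matrix.
    w≡ : ∀ x → w x ≡ q * v x + q * r * u x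
    w≡ x = begin
      w x ≡⟨ comb-*ᵥ q (- (q * q)) (q * r) (Λ R′) v x ⟩
      q * v x + (- (q * q)) * sum v + q * r * (Λ R′ *ᵥ v) x
        ≡⟨ cong₂ (λ y z → q * v x + (- (q * q)) * y + q * r * z) v0 (Λv≡u x) ⟩
      q * v x + (- (q * q)) * 0ℚ + q * r * u x
        ≡⟨ solve 4 (λ q v r u →
             q :* v :+ (:- (q :* q)) :* con 0ℚ :+ q :* r :* u
             := q :* v :+ q :* r :* u) refl q (v x) r (u x) ⟩
      q * v x + q * r * u x ∎
    ·w : ∀ z → z · w ≡ q * (z · v) + q * r * (z · u)
    ·w z = begin
      z · w ≡⟨ sum-cong-≗ (λ x → trans (cong (z x *_) (w≡ x))
                 (solve 5 (λ z q v r u → z :* (q :* v :+ q :* r :* u) := q :* (z :* v) :+ q :* r :* (z :* u)) refl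
                   (z x) q (v x) r (u x))) ⟩
      sum (λ x → q * (z x * v x) + q * r * (z x * u x))
        ≡⟨ sum-lin₂ q (q * r) (λ x → z x * v x) (λ x → z x * u x) ⟩
      q * (z · v) + q * r * (z · u) ∎
    v·w : v · w ≡ q * (2ℚ + r)
    v·w = begin
      v · w                          ≡⟨ ·w v ⟩
      q * (v · v) + q * r * (v · u)  ≡⟨ cong₂ (λ y z → q * y + q * r * z) v·v v·u ⟩
      q * 2ℚ + q * r * 1ℚ
        ≡⟨ solve 2 (λ q r → q :* con 2ℚ :+ q :* r :* con 1ℚ := q :* (con 2ℚ :+ r)) refl q r ⟩
      q * (2ℚ + r)                   ∎
    u·w : u · w ≡ q * (1ℚ + 2ℚ * r)
    u·w = begin
      u · w                          ≡⟨ ·w u ⟩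
      q * (u · v) + q * r * (u · u)
        ≡⟨ cong₂ (λ y z → q * y + q * r * z) (trans (·-comm u v) v·u) u·u ⟩
      q * 1ℚ + q * r * 2ℚ
        ≡⟨ solve 2 (λ q r →
             q :* con 1ℚ :+ q :* r :* con 2ℚ := q :* (con 1ℚ :+ con 2ℚ :* r)) refl q r ⟩
      q * (1ℚ + 2ℚ * r)              ∎
    w·w : w · w ≡ q * q * (2ℚ + 2ℚ * r + 2ℚ * (r * r))
    w·w = begin
      w · w                          ≡⟨ ·w w ⟩
      q * (w · v) + q * r * (w · u)
        ≡⟨ cong₂ (λ y z → q * y + q * r * z) (trans (·-comm w v) v·w) (trans (·-comm w u) u·w) ⟩
      q * (q * (2ℚ + r)) + q * r * (q * (1ℚ + 2ℚ * r))
        ≡⟨ solve 2 (λ q r → q :* (q :* (con 2ℚ :+ r)) :+ q :* r :* (q :* (con 1ℚ :+ con 2ℚ :* r))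
             := q :* q :* (con 2ℚ :+ con 2ℚ :* r :+ con 2ℚ :* (r :* r))) refl q r ⟩
      q * q * (2ℚ + 2ℚ * r + 2ℚ * (r * r)) ∎
    L≡ : ∀ x y → comb (ι n) (- 1ℚ) (- 1ℚ) (Λ R′) x y - v x * v y ≡ laplacian (K n ─ F) x y
    L≡ x y = begin
      ι n * basis x y + (- 1ℚ) * 1ℚ + (- 1ℚ) * Λ R′ x y - v x * v y
        ≡⟨ solve 3 (λ d l m →
             d :+ con (- 1ℚ) :* l :- m
             := d :+ con (- 1ℚ) :* (l :+ m)) refl
             (ι n * basis x y + (- 1ℚ) * 1ℚ) (Λ R′ x y) (v x * v y) ⟩
      ι n * basis x y + (- 1ℚ) * 1ℚ + (- 1ℚ) * (Λ R′ x y + v x * v y)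
        ≡⟨ cong (λ z → ι n * basis x y + (- 1ℚ) * 1ℚ + (- 1ℚ) * z) (sym (Λ-split x y)) ⟩
      comb (ι n) (- 1ℚ) (- 1ℚ) (Λ (has F)) x y ≡⟨ sym (laplacian-─ F x y) ⟩
      laplacian (K n ─ F) x y ∎

-- Degree sum and partners in a matching

ι-ℕsum : (f : Fin m → ℕ) → ι (ℕΣ.sum f) ≡ sum (ι ∘ f)
ι-ℕsum {zero}  f = refl
ι-ℕsum {suc m} f = trans (ι-+ (f zero) (ℕΣ.sum (f ∘ suc))) (cong (λ z → ι (f zero) + z) (ι-ℕsum (f ∘ suc)))

module _ (M : EdgeSet (K n)) where

  handshake : sum (deg (has M)) ≡ 2ℚ * ι (size M)
  handshake = begin
    sum (deg (has M))
      ≡⟨ sym (pairSum-double ⟦ has M ⟧ (λ x y → cong (if_then 1ℚ else 0ℚ) (has-sym M x y))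
           (λ x → cong (if_then 1ℚ else 0ℚ) (has-irrefl M x))) ⟩
    pairSum ⟦ has M ⟧ + pairSum ⟦ has M ⟧ ≡⟨ cong (λ z → z + z) (sym ι-size) ⟩
    ι (size M) + ι (size M)        ≡⟨ solve 1 (λ s → s :+ s := con 2ℚ :* s) refl (ι (size M)) ⟩
    2ℚ * ι (size M)                ∎
    where
    entry : ∀ p q → ι (if p ∧ q then 1 else 0) ≡ (if p then (if q then 1ℚ else 0ℚ) else 0ℚ)
    entry true  true  = refl
    entry true  false = refl
    entry false _     = refl
    ι-size : ι (size M) ≡ pairSum ⟦ has M ⟧
    ι-size = trans (ι-ℕsum {n} _) (sum-cong-≗ (λ i →
      trans (ι-ℕsum {n} _) (sum-cong-≗ (λ j → entry (does (i Fin.<? j)) (has M i j)))))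

  -- Two edges at `x` are not disjoint, so they cannot be different; decidable equality removes the
  -- double negation.
  isMatchingRelation : IsMatching M → IsMatchingRelation (has M)
  isMatchingRelation matching = record
    { R-sym      = has-sym M
    ; R-irrefl   = has-irrefl M
    ; functional = λ {x} {y} {z} s t → decidable-stable (y Fin.≟ z) (λ y≢z →
        proj₁ (matching x y x z s t
          (λ { (inj₁ (_ , y≡z)) → y≢z y≡z ; (inj₂ (x≡z , y≡x)) → y≢z (trans y≡x x≡z) })) refl)
    }

-- The scalar identities behind the final quotient

module _ {N q r t : ℚ} (qN : q * N ≡ 1ℚ) (rN : r * (N - 2ℚ) ≡ 1ℚ)
  (tN : t * ((N - 1ℚ) * (N - (2ℚ + 1ℚ))) ≡ 1ℚ) where

  -- Clearing denominators in `1 - q (2 + r)` leaves `N (N-2) - 2 (N-2) - 1 = (N-1)(N-3)`, whose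
  -- reciprocal is `t`.
  update-scale : N * (N - 2ℚ) * t * (1ℚ - q * (2ℚ + r)) ≡ 1ℚ
  update-scale = begin
    N * (N - 2ℚ) * t * (1ℚ - q * (2ℚ + r))
      ≡⟨ solve 4 (λ N q r t → N :* (N :- con 2ℚ) :* t :* (con 1ℚ :- q :* (con 2ℚ :+ r))
           := t :* (N :* (N :- con 2ℚ) :- q :* N :* (con 2ℚ :* (N :- con 2ℚ) :+ r :* (N :- con 2ℚ)))) refl N q r t ⟩
    t * (N * (N - 2ℚ) - q * N * (2ℚ * (N - 2ℚ) + r * (N - 2ℚ)))
      ≡⟨ cong₂ (λ x y → t * (N * (N - 2ℚ) - x * (2ℚ * (N - 2ℚ) + y))) qN rN ⟩
    t * (N * (N - 2ℚ) - 1ℚ * (2ℚ * (N - 2ℚ) + 1ℚ))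
      ≡⟨ solve 2 (λ N t → t :* (N :* (N :- con 2ℚ) :- con 1ℚ :* (con 2ℚ :* (N :- con 2ℚ) :+ con 1ℚ))
           := t :* ((N :- con 1ℚ) :* (N :- (con 2ℚ :+ con 1ℚ)))) refl N t ⟩
    t * ((N - 1ℚ) * (N - (2ℚ + 1ℚ))) ≡⟨ tN ⟩
    1ℚ ∎

  -- `τ` is the degree sum of the path graph without `bc`, and `τ + 2` that of `M`, which has one
  -- more edge. Only the excess 2 survives the subtraction, so the result does not depend on `p`.
  Kf-difference : (τ : ℚ) →
    N * (q * N + (- (q * q)) * N + q * r * τ + N * (N - 2ℚ) * t * (q * q * (2ℚ + 2ℚ * r + 2ℚ * (r * r))))
      - N * (q * N + (- (q * q)) * N + q * r * (τ + 2ℚ)) ≡ 2ℚ * N * r * t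
  Kf-difference τ = begin
    N * (q * N + (- (q * q)) * N + q * r * τ + N * (N - 2ℚ) * t * (q * q * (2ℚ + 2ℚ * r + 2ℚ * (r * r))))
      - N * (q * N + (- (q * q)) * N + q * r * (τ + 2ℚ))
      ≡⟨ solve 5 (λ N q r t τ →
           N :* (q :* N :+ (:- (q :* q)) :* N :+ q :* r :* τ
             :+ N :* (N :- con 2ℚ) :* t :* (q :* q :* (con 2ℚ :+ con 2ℚ :* r :+ con 2ℚ :* (r :* r))))
             :- N :* (q :* N :+ (:- (q :* q)) :* N :+ q :* r :* (τ :+ con 2ℚ))
           := q :* N :* (q :* N) :* t :* (con 2ℚ :* (N :- con 2ℚ) :+ con 2ℚ :* (r :* (N :- con 2ℚ))
             :+ con 2ℚ :* (r :* (N :- con 2ℚ)) :* r) :- q :* N :* (con 2ℚ :* r))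
           refl N q r t τ ⟩
    q * N * (q * N) * t * (2ℚ * (N - 2ℚ) + 2ℚ * (r * (N - 2ℚ)) + 2ℚ * (r * (N - 2ℚ)) * r) - q * N * (2ℚ * r)
      ≡⟨ cong₂ (λ x y → x * x * t * (2ℚ * (N - 2ℚ) + 2ℚ * y + 2ℚ * y * r) - x * (2ℚ * r)) qN rN ⟩
    1ℚ * 1ℚ * t * (2ℚ * (N - 2ℚ) + 2ℚ * 1ℚ + 2ℚ * 1ℚ * r) - 1ℚ * (2ℚ * r)
      -- Writing this 1 as `t (N-1)(N-3)` makes `t` a common factor. Since
      -- `(N-1)(N-3) = (N-2)² - 1`, the remaining `r` then meets a factor `N - 2` and cancels.
      ≡⟨ cong (λ x → 1ℚ * 1ℚ * t * (2ℚ * (N - 2ℚ) + 2ℚ * 1ℚ + 2ℚ * 1ℚ * r) - x * (2ℚ * r))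
           (sym tN) ⟩
    1ℚ * 1ℚ * t * (2ℚ * (N - 2ℚ) + 2ℚ * 1ℚ + 2ℚ * 1ℚ * r) - t * ((N - 1ℚ) * (N - (2ℚ + 1ℚ))) * (2ℚ * r)
      ≡⟨ solve 3 (λ N r t →
           con 1ℚ :* con 1ℚ :* t :* (con 2ℚ :* (N :- con 2ℚ) :+ con 2ℚ :* con 1ℚ :+ con 2ℚ :* con 1ℚ :* r)
             :- t :* ((N :- con 1ℚ) :* (N :- (con 2ℚ :+ con 1ℚ))) :* (con 2ℚ :* r)
           := con 2ℚ :* t :* ((N :- con 2ℚ) :+ con 1ℚ :+ con 2ℚ :* r :- r :* (N :- con 2ℚ) :* (N :- con 2ℚ))) refl N r t ⟩
    2ℚ * t * ((N - 2ℚ) + 1ℚ + 2ℚ * r - r * (N - 2ℚ) * (N - 2ℚ))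
      ≡⟨ cong (λ x → 2ℚ * t * ((N - 2ℚ) + 1ℚ + 2ℚ * r - x * (N - 2ℚ))) rN ⟩
    2ℚ * t * ((N - 2ℚ) + 1ℚ + 2ℚ * r - 1ℚ * (N - 2ℚ))
      ≡⟨ solve 3 (λ N r t →
           con 2ℚ :* t :* ((N :- con 2ℚ) :+ con 1ℚ :+ con 2ℚ :* r :- con 1ℚ :* (N :- con 2ℚ))
           := con 2ℚ :* t :* (con 1ℚ :+ con 2ℚ :* r)) refl N r t ⟩
    2ℚ * t * (1ℚ + 2ℚ * r)
      -- With `1 = r (N - 2)`, the factor `1 + 2r` becomes `r N`.
      ≡⟨ cong (λ x → 2ℚ * t * (x + 2ℚ * r)) (sym rN) ⟩
    2ℚ * t * (r * (N - 2ℚ) + 2ℚ * r)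
      ≡⟨ solve 3 (λ N r t →
           con 2ℚ :* t :* (r :* (N :- con 2ℚ) :+ con 2ℚ :* r)
           := con 2ℚ :* N :* r :* t) refl N r t ⟩
    2ℚ * N * r * t ∎

  -- `r * t` is the reciprocal of `D`, so the quotient is identified by its product with `D` and
  -- never has to be unfolded.
  quotient-eq : ∀ {x D} → D ≡ (N - 1ℚ) * (N - 2ℚ) * (N - (2ℚ + 1ℚ)) → x * D ≡ 2ℚ * N → 2ℚ * N * r * t ≡ x
  quotient-eq {x} {D} D≡ xD = begin
    2ℚ * N * r * t ≡⟨ cong (λ z → z * r * t) (sym (trans (cong (x *_) (sym D≡)) xD)) ⟩
    x * ((N - 1ℚ) * (N - 2ℚ) * (N - (2ℚ + 1ℚ))) * r * t
      ≡⟨ solve 4 (λ N r t x →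
           x :* ((N :- con 1ℚ) :* (N :- con 2ℚ) :* (N :- (con 2ℚ :+ con 1ℚ))) :* r :* t
           := x :* (r :* (N :- con 2ℚ)) :* (t :* ((N :- con 1ℚ) :* (N :- (con 2ℚ :+ con 1ℚ))))) refl N r t x ⟩
    x * (r * (N - 2ℚ)) * (t * ((N - 1ℚ) * (N - (2ℚ + 1ℚ)))) ≡⟨ cong₂ (λ y z → x * y * z) rN tN ⟩
    x * 1ℚ * 1ℚ ≡⟨ trans (*-identityʳ (x * 1ℚ)) (*-identityʳ x) ⟩
    x ∎

corollary6p1 :
    (p n : ℕ) → p ≥ 2 → (n≥ : n ≥ 4 ⊔ 2 ℕ.* p) →
    (F₀ : EdgeSet (K n)) → deletionGraph F₀ ≅ P 3 ∪ (p ∸ 2) copies K 2 →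
    (M : EdgeSet (K n)) → IsMatching M → size M ≡ p →
    let instance _ = denominator-nonZero p n≥ in
    Kf (K n ─ F₀) - Kf (K n ─ M)
      ≡ + (2 ℕ.* n) / ((n ∸ 1) ℕ.* (n ∸ 2) ℕ.* (n ∸ 3))
corollary6p1 p@(suc (suc k)) n (ℕ.s≤s (ℕ.s≤s ℕ.z≤n)) n≥ F₀ iso M matching size≡p
  with ℕ.≤-trans (ℕ.m≤m⊔n 4 (2 ℕ.* p)) n≥
-- Matching on `4 ≤ n` lets the truncated subtractions compute to `n₁`, `n₂`, `n₃`, and keeps `n₃`
-- positive.
corollary6p1 p@(suc (suc k)) n@(suc n₁@(suc n₂@(suc n₃@(suc _)))) _ n≥ F₀ iso M matching size≡p
  | ℕ.s≤s (ℕ.s≤s (ℕ.s≤s (ℕ.s≤s ℕ.z≤n))) = begin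
    Kf (K n ─ F₀) - Kf (K n ─ M)
      ≡⟨ cong₂ _-_ (Kf-matchingPlusPath {q = q} {r} qN rN {N * (N - 2ℚ) * t} (update-scale {N} {q} {r} {t} qN rN tN)
                                        F₀ (matchingPlusPath F₀ iso))
                   (Kf-matching {q = q} {r} qN rN M (isMatchingRelation M matching)) ⟩
    N * (q * N + (- (q * q)) * N + q * r * τ + N * (N - 2ℚ) * t * (q * q * (2ℚ + 2ℚ * r + 2ℚ * (r * r))))
      - N * (q * N + (- (q * q)) * N + q * r * sum (deg (has M)))
      ≡⟨ cong (λ z → N * (q * N + (- (q * q)) * N + q * r * τ + N * (N - 2ℚ) * t * (q * q * (2ℚ + 2ℚ * r + 2ℚ * (r * r))))
                     - N * (q * N + (- (q * q)) * N + q * r * z))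
           M-total ⟩
    N * (q * N + (- (q * q)) * N + q * r * τ + N * (N - 2ℚ) * t * (q * q * (2ℚ + 2ℚ * r + 2ℚ * (r * r))))
      - N * (q * N + (- (q * q)) * N + q * r * (τ + 2ℚ))
      ≡⟨ Kf-difference {N} {q} {r} {t} qN rN tN τ ⟩
    2ℚ * N * r * t
      ≡⟨ quotient-eq {N} {q} {r} {t} qN rN tN D≡ (trans (/-*-cancel (2 ℕ.* n) D) (ι-* 2 n)) ⟩
    + (2 ℕ.* n) / D ∎
    where
    D : ℕ
    D = n₁ ℕ.* n₂ ℕ.* n₃
    N τ : ℚ
    N = ι n
    τ = sum (deg (IsMatchingPlusPath.R′ (matchingPlusPath F₀ iso)))
    N-1 : N - 1ℚ ≡ ι n₁
    N-1 = trans (cong (_- 1ℚ) (ι-+ 1 n₁)) (solve 1 (λ x → con 1ℚ :+ x :- con 1ℚ := x) refl (ι n₁))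
    N-2 : N - 2ℚ ≡ ι n₂
    N-2 = trans (cong (_- 2ℚ) (ι-+ 2 n₂)) (solve 1 (λ x → con 2ℚ :+ x :- con 2ℚ := x) refl (ι n₂))
    N-3 : N - (2ℚ + 1ℚ) ≡ ι n₃
    N-3 = trans (cong (_- (2ℚ + 1ℚ)) (ι-+ 3 n₃)) (solve 1 (λ x → con (2ℚ + 1ℚ) :+ x :- con (2ℚ + 1ℚ) := x) refl (ι n₃))
    instance
      _ = ι-suc-nonZero (ℕ.pred n)
      _ = ι-suc-nonZero (ℕ.pred n₁)
      _ = ι-suc-nonZero (ℕ.pred n₂)
      _ = ι-suc-nonZero (ℕ.pred n₃)
    q r t : ℚ
    q = 1/ ι n
    r = 1/ ι n₂
    t = 1/ ι n₁ * 1/ ι n₃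
    qN : q * N ≡ 1ℚ
    qN = *-inverseˡ (ι n)
    rN : r * (N - 2ℚ) ≡ 1ℚ
    rN = trans (cong (r *_) N-2) (*-inverseˡ (ι n₂))
    tN : t * ((N - 1ℚ) * (N - (2ℚ + 1ℚ))) ≡ 1ℚ
    tN = begin
      t * ((N - 1ℚ) * (N - (2ℚ + 1ℚ)))      ≡⟨ cong₂ (λ x y → t * (x * y)) N-1 N-3 ⟩
      1/ ι n₁ * 1/ ι n₃ * (ι n₁ * ι n₃)
        ≡⟨ solve 4 (λ a b c d →
             a :* b :* (c :* d) := a :* c :* (b :* d)) refl (1/ ι n₁) (1/ ι n₃) (ι n₁) (ι n₃) ⟩
      1/ ι n₁ * ι n₁ * (1/ ι n₃ * ι n₃)     ≡⟨ cong₂ _*_ (*-inverseˡ (ι n₁)) (*-inverseˡ (ι n₃)) ⟩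
      1ℚ * 1ℚ                               ≡⟨⟩
      1ℚ                                    ∎
    -- With `p = k + 2`, the matching inside `F₀` has `k + 1` edges against the `k + 2` of `M`: one
    -- edge, hence 2 in the degree sum.
    M-total : sum (deg (has M)) ≡ τ + 2ℚ
    M-total = begin
      sum (deg (has M))      ≡⟨ handshake M ⟩
      2ℚ * ι (size M)        ≡⟨ cong (λ z → 2ℚ * ι z) size≡p ⟩
      2ℚ * ι (suc (suc k))   ≡⟨ cong (2ℚ *_) (ι-+ 1 (suc k)) ⟩
      2ℚ * (1ℚ + ι (suc k))
        ≡⟨ solve 1 (λ x → con 2ℚ :* (con 1ℚ :+ x) := con 2ℚ :* x :+ con 2ℚ) refl (ι (suc k)) ⟩
      2ℚ * ι (suc k) + 2ℚ    ≡⟨ cong (_+ 2ℚ) (sym (sum-deg F₀ iso)) ⟩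
      τ + 2ℚ                 ∎
    D≡ : ι D ≡ (N - 1ℚ) * (N - 2ℚ) * (N - (2ℚ + 1ℚ))
    D≡ = trans (ι-* (n₁ ℕ.* n₂) n₃) (trans (cong (_* ι n₃) (ι-* n₁ n₂))
           (sym (cong₂ _*_ (cong₂ _*_ N-1 N-2) N-3)))
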